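{- Provability in CK and in CK+ID is decidable in $O(n\log n)$ space, where $n=|D|$ is the number of symbols occurring in the string representing the input formula $D$.
   Context: Formulas are built from propositional variables (a countable set $ATM$) and $\bot$ by the binary connectives $\to$ and $\Rightarrow$. A (selection function) model is $\mathcal{M}=\langle \mathcal{W}, f, [\,]\rangle$ with $\mathcal{W}\neq\emptyset$ a set of worlds, $f:\mathcal{W}\times 2^{\mathcal{W}}\to 2^{\mathcal{W}}$, and $[\,]$ assigning to each $P\in ATM$ a subset $[P]\subseteq\mathcal{W}$, extended by $[\bot]=\emptyset$, $[A\to B]=(\mathcal{W}\setminus[A])\cup[B]$, $[A\Rightarrow B]=\{w\in\mathcal{W}: f(w,[A])\subseteq[B]\}$. The logic CK consists of the formulas $D$ valid in all models (i.e. $[D]=\mathcal{W}$ in every model); CK+ID consists of the formulas valid in all models such that $f(w,[A])\subseteq[A]$ for all worlds $w$ and formulas $A$. Provability of $D$ in one of these logics means membership of $D$ in it (the semantics characterizes the logic). Space is measured in bits of working storage. -}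

module Defs where

open import Data.Bool.Base using (Bool)
open import Data.Digit using (Bit; toDigits)
open import Data.Fin.Base using (Fin)
open import Data.List.Base using (List; []; _∷_; [_]; _++_; map; length)
open import Data.Nat.Base using (ℕ; suc; _+_; _*_; _≤_)
open import Data.Nat.Logarithm using (⌈log₂_⌉)
open import Data.Product.Base using (Σ-syntax; ∃; ∃-syntax; _×_; _,_; proj₁; proj₂)
open import Data.Sum.Base using (_⊎_; inj₁; inj₂)
open import Data.Vec.Base as Vec using (Vec)
open import Function.Bundles using (_↔_)
open import Level using (0ℓ) renaming (suc to lsuc)
open import Relation.Binary.Construct.Closure.ReflexiveTransitive using (Star)
open import Relation.Binary.PropositionalEquality using (_≡_)
open import Relation.Nullary.Reflects using (Reflects)
open import Relation.Unary using (Pred; ∅; ∁; _∪_; _⊆_; _≐_; Universal)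

ATM : Set
ATM = ℕ

infixr 6 _⟶_
infix  7 _⇒_

data Formula : Set where
  var : ATM → Formula
  ⊥′  : Formula
  _⟶_ : Formula → Formula → Formula
  _⇒_ : Formula → Formula → Formula

-- Subsets of W are predicates on W, and equality of subsets is _≐_.
-- Since _≐_ is weaker than propositional equality of predicates, the
-- fact that f is a function of subsets has to be required: f-cong.

record Model : Set₁ where
  field
    W      : Set
    w₀     : W
    f      : W → Pred W 0ℓ → Pred W 0ℓ
    f-cong : ∀ w {P Q} → P ≐ Q → f w P ≐ f w Q
    val    : ATM → Pred W 0ℓ

  ⟦_⟧ : Formula → Pred W 0ℓ
  ⟦ var p ⟧ = val p
  ⟦ ⊥′ ⟧    = ∅
  ⟦ A ⟶ B ⟧ = ∁ ⟦ A ⟧ ∪ ⟦ B ⟧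
  ⟦ A ⇒ B ⟧ = λ w → f w ⟦ A ⟧ ⊆ ⟦ B ⟧

  SatisfiesID : Set
  SatisfiesID = ∀ w A → f w ⟦ A ⟧ ⊆ ⟦ A ⟧

CK : Pred Formula (lsuc 0ℓ)
CK D = (M : Model) → Universal (Model.⟦_⟧ M D)

CK+ID : Pred Formula (lsuc 0ℓ)
CK+ID D = (M : Model) → Model.SatisfiesID M → Universal (Model.⟦_⟧ M D)

data Symbol : Set where
  falsum imp cond lpar rpar atom : Symbol
  digit : Bit → Symbol

-- The variable with index i is written as the symbol "atom" followed by
-- the binary digits of i, least significant digit first.

string : Formula → List Symbol
string (var i) = atom ∷ map digit (proj₁ (toDigits 2 i))
string ⊥′      = [ falsum ]
string (A ⟶ B) = lpar ∷ string A ++ imp  ∷ string B ++ [ rpar ]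
string (A ⇒ B) = lpar ∷ string A ++ cond ∷ string B ++ [ rpar ]

∣_∣ : Formula → ℕ
∣ D ∣ = length (string D)

data Move : Set where
  left right stay : Move

-- The cells to the left of the head (nearest first), the scanned cell,
-- and the cells to the right of the head (nearest first).

record Tape (C : Set) : Set where
  constructor tape
  field
    lefts  : List C
    head   : C
    rights : List C

  size : ℕ
  size = length lefts + suc (length rights)

-- A work tape is infinite in both directions; only the cells visited so
-- far are recorded, all others being blank.  Its size never decreases.

workMove : ∀ {C} → C → Move → Tape C → Tape C
workMove b left  (tape []       c rs)       = tape [] b (c ∷ rs)
workMove b left  (tape (l ∷ ls) c rs)       = tape ls l (c ∷ rs)
workMove b right (tape ls       c [])       = tape (c ∷ ls) b []
workMove b right (tape ls       c (r ∷ rs)) = tape (c ∷ ls) r rs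
workMove b stay  t                          = t

write : ∀ {C} → C → Tape C → Tape C
write c t = record t { head = c }

-- The input tape holds the input between two end markers, which the
-- head cannot pass; it is never written to.

data Cell (Σᵢ : Set) : Set where
  ⊢ ⊣ : Cell Σᵢ
  sym : Σᵢ → Cell Σᵢ

inputMove : ∀ {C} → Move → Tape C → Tape C
inputMove left  t@(tape []       c rs)       = t
inputMove left    (tape (l ∷ ls) c rs)       = tape ls l (c ∷ rs)
inputMove right t@(tape ls       c [])       = t
inputMove right   (tape ls       c (r ∷ rs)) = tape (c ∷ ls) r rs
inputMove stay  t                            = t

-- Deterministic Turing machines with a two-way read-only input tape and
-- finitely many work tapes, over an input alphabet Σᵢ

data Action (Q Γ : Set) (k : ℕ) : Set where
  halt     : Bool → Action Q Γ k
  continue : Q → Move → Vec (Γ × Move) k → Action Q Γ k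

record Configuration (Q Σᵢ Γ : Set) (k : ℕ) : Set where
  constructor config
  field
    state : Q
    input : Tape (Cell Σᵢ)
    work  : Vec (Tape Γ) k

-- At least two work symbols: a one-symbol cell would hold 0 bits, but
-- head positions on such tapes would be an unbounded free memory.

record Machine (Σᵢ : Set) : Set₁ where
  field
    State    : Set
    ∣State∣  : ℕ
    finState : State ↔ Fin ∣State∣
    Γ        : Set
    ∣Γ∣      : ℕ
    finΓ     : Γ ↔ Fin ∣Γ∣
    2≤∣Γ∣    : 2 ≤ ∣Γ∣
    #tapes   : ℕ
    start    : State
    blank    : Γ
    δ        : State → Cell Σᵢ → Vec Γ #tapes → Action State Γ #tapes

  Config : Set
  Config = Configuration State Σᵢ Γ #tapes

  initial : List Σᵢ → Config
  initial x = config start (tape [] ⊢ (map sym x ++ [ ⊣ ]))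
                     (Vec.replicate #tapes (tape [] blank []))

  step : Config → Bool ⊎ Config
  step (config q i ts) with δ q (Tape.head i) (Vec.map Tape.head ts)
  ... | halt b           = inj₁ b
  ... | continue q′ m as = inj₂ (config q′ (inputMove m i)
          (Vec.zipWith (λ (c , m′) t → workMove blank m′ (write c t)) as ts))

  _↦_ : Config → Config → Set
  c ↦ c′ = step c ≡ inj₂ c′

  _↦*_ : Config → Config → Set
  _↦*_ = Star _↦_

  Outputs : List Σᵢ → Bool → Set
  Outputs x b = ∃[ c ] (initial x ↦* c × step c ≡ inj₁ b)

  bits : Config → ℕ
  bits c = Vec.sum (Vec.map Tape.size (Configuration.work c)) * ⌈log₂ ∣Γ∣ ⌉

  RunsInSpace : List Σᵢ → ℕ → Set
  RunsInSpace x s = ∀ c → initial x ↦* c → bits c ≤ s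

O : (ℕ → ℕ) → Pred (ℕ → ℕ) 0ℓ
O g s = ∃[ c ] ∃[ n₀ ] (∀ n → n₀ ≤ n → s n ≤ c * g n)

DecidableInSpaceO : (ℕ → ℕ) → Pred Formula (lsuc 0ℓ) → Set₁
DecidableInSpaceO g L =
  Σ[ M ∈ Machine Symbol ]
    (∀ D → ∃[ b ] (Machine.Outputs M (string D) b × Reflects (L D) b)) ×
    (∃[ s ] (O g s × (∀ D → Machine.RunsInSpace M (string D) (s ∣ D ∣))))

{-# OPTIONS --safe #-}
module Submission where

-- A world of a model is described by a set of signed formulas.  Decomposing
-- the implications leaves signed variables and conditionals; such a set is
-- satisfiable iff the variables do not clash and each failing C ⇒ E can be
-- given a world refuting E (and satisfying C, for CK+ID) and satisfying B
-- for every holding A ⇒ B, except where A and C are not equivalent.  As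
-- inequivalence is satisfiability of one of two smaller sets, this is a game
-- in which positions only shrink, and every move is a choice between two
-- alternatives.  An alternating machine with six stacks plays it on strings,
-- in linear space and with linearly many choices, and a deterministic machine
-- finds the winner in linear space by depth-first search, remembering the
-- choices made and recomputing everything else.

open import Defs
open import Axiom.ExcludedMiddle using (ExcludedMiddle)
open import Data.Bool.Base using (Bool; true; false; not; if_then_else_; _∧_; _∨_)
import Data.Bool.Properties as Bool
open import Data.Digit using (Bit; toDigits; fromDigits)
open import Data.Empty using (⊥-elim)
open import Data.Fin.Base using (Fin; zero; suc)
open import Data.Fin.Patterns
import Data.Fin.Properties as Fin
open import Data.List.Base using (List; []; _∷_; [_]; _++_; map; length; replicate; head; drop; _ʳ++_)
open import Data.List.Membership.Propositional using (_∈_)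
open import Data.List.Properties using (length-++; length-map; ++-assoc; ++-identityʳ; map-ʳ++; map-∘; map-injective; reverse-injective; ∷-injective)
open import Data.List.Relation.Unary.All as All using (All; []; _∷_)
open import Data.List.Relation.Unary.AllPairs using (AllPairs; []; _∷_)
open import Data.List.Relation.Unary.Any using (here; there)
open import Data.Maybe.Base using (Maybe; just; nothing)
open import Data.Nat.Base using (ℕ; zero; suc; _+_; _*_; _≤_; _<_; z≤n; s≤s)
open import Data.Nat.Logarithm using (⌊log₂_⌋; ⌈log₂_⌉; ⌊log₂⌋-mono-≤)
open import Data.Nat.Properties
open import Data.Nat.Tactic.RingSolver using (solve-∀)
open import Data.Product.Base using (Σ-syntax; ∃-syntax; _×_; _,_; proj₁; proj₂)
open import Data.Product.Function.NonDependent.Propositional using (_×-↔_)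
open import Data.Sum.Base using (_⊎_; inj₁; inj₂)
open import Data.Sum.Function.Propositional using (_⊎-↔_)
open import Data.Unit.Base using (⊤; tt)
open import Data.Vec.Base as Vec using (Vec; []; _∷_; lookup; updateAt; tabulate)
open import Data.Vec.Properties using (lookup-zipWith; lookup-map; lookup∘tabulate; lookup∘updateAt; lookup∘updateAt′; lookup-replicate)
open import Function.Base using (_∘_; id)
open import Function.Bundles using (_↔_)
open import Function.Properties.Inverse using (↔-refl; ↔-sym; ↔-trans)
open import Level using (Level; 0ℓ) renaming (suc to lsuc)
open import Relation.Binary.Construct.Closure.ReflexiveTransitive using (Star; ε; _◅_; _◅◅_)
open import Relation.Binary.PropositionalEquality using (_≡_; _≢_; refl; trans; cong; subst; module ≡-Reasoning) renaming (sym to ≡-sym)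
open import Relation.Nullary using (¬_; Dec; yes; no; does)
import Relation.Nullary.Decidable as Dec
open import Relation.Nullary.Reflects using (Reflects; ofʸ; ofⁿ; ¬-reflects; _×-reflects_; _⊎-reflects_)
open import Relation.Unary using (Pred; Universal; _≐_; _⊆_)

-- The obstacle is that a recursive search storing one position per level keeps linearly many
-- positions of linear size, hence quadratic space. Here a play consumes its own position: no move
-- ever needs an earlier one, so the stacks hold a single position and a level of the search leaves
-- only one symbol behind. Stack contents and pending choices share the same tapes, so a single
-- budget, threaded through `Run`, bounds them together; the `cost` of a set of signed formulas is
-- both this budget and the measure that decreases. Deterministic space then comes out linear, and
-- the factor `⌊log₂ n ⌋` enters only because it is at least 1 from 2 on. Excluded middle at level 0
-- is applied only to statements about one model. Satisfiability quantifies over models and lives in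
-- `Set₁`; its truth value always comes from a `Run` of the game, together with a `Reflects` proof.

Finite : Set → Set
Finite A = ∃[ n ] (A ↔ Fin n)

⊤-finite : Finite ⊤
⊤-finite = 1 , ↔-sym Fin.1↔⊤

Bool-finite : Finite Bool
Bool-finite = 2 , ↔-sym Fin.2↔Bool

Fin-finite : ∀ {n} → Finite (Fin n)
Fin-finite = _ , ↔-refl

infixr 1 _⊎-finite_
infixr 2 _×-finite_

_⊎-finite_ : ∀ {A B} → Finite A → Finite B → Finite (A ⊎ B)
(m , f) ⊎-finite (n , g) = m + n , ↔-trans (f ⊎-↔ g) (↔-sym Fin.+↔⊎)

_×-finite_ : ∀ {A B} → Finite A → Finite B → Finite (A × B)
(m , f) ×-finite (n , g) = m * n , ↔-trans (f ×-↔ g) (↔-sym Fin.*↔×)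

-- Alternating stack machines with a space budget.

-- A player is identified with the outcome of a play which that player wins.

Player : Set
Player = Bool

pattern Verifier = true
pattern Refuter  = false

combine : Player → Bool → Bool → Bool
combine Verifier = _∨_
combine Refuter  = _∧_

Push : ℕ → Set → Set
Push k Γ = ⊤ ⊎ (Fin k × Γ)

pattern no-push    = inj₁ tt
pattern _◂_ r x = inj₂ (r , x)

-- Pushes are attached to jumps, which saves intermediate labels. They take effect from left to
-- right, so the symbol of the last push ends on top.
Target : ℕ → Set → Set → Set
Target k Γ Label = (Push k Γ × Push k Γ × Push k Γ) × Label

pattern goto l = (no-push , no-push , no-push) , l

data Instr (Σᵢ Label Γ : Set) (k : ℕ) : Set where
  halt   : Bool → Instr Σᵢ Label Γ k
  choose : Player → Target k Γ Label → Target k Γ Label → Instr Σᵢ Label Γ k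
  pop    : Fin k → (Maybe Γ → Target k Γ Label) → Instr Σᵢ Label Γ k
  read   : (Maybe Σᵢ → Target k Γ Label) → Instr Σᵢ Label Γ k

record AlternatingMachine (Σᵢ : Set) : Set₁ where
  field
    Label   : Set
    Γ       : Set
    #stacks : ℕ
    labels  : Finite Label
    symbols : Finite Γ
    entry   : Label
    instr   : Label → Instr Σᵢ Label Γ #stacks

  Stacks : Set
  Stacks = Vec (List Γ) #stacks

  empty : Stacks
  empty = Vec.replicate #stacks []

  record Position : Set where
    constructor position
    field
      target : Target #stacks Γ Label
      input  : List Σᵢ
      stacks : Stacks

  push : Fin #stacks → Γ → Stacks → Stacks
  push r x st = updateAt st r (x ∷_)

  -- Space as a currency: a push or a choice costs one unit (the choice
  -- will have to be remembered), and a pop releases one.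

  refund : List Γ → ℕ → ℕ
  refund []      g = g
  refund (_ ∷ _) g = suc g

  -- Being inductive, a run is a finite game tree with both branches of every choice, so termination
  -- is part of the data. The two branches have the same budget because they are searched one after
  -- the other in the same space.
  data Run : ℕ → Position → Bool → Set where
    pushing  : ∀ {g b r x p q l i st} →
               Run g (position ((p , q , no-push) , l) i (push r x st)) b →
               Run (suc g) (position ((r ◂ x , p , q) , l) i st) b
    halting  : ∀ {g b p q l i st} → instr l ≡ halt b →
               Run g (position ((no-push , p , q) , l) i st) b
    choosing : ∀ {g b₀ b₁ o t₀ t₁ p q l i st} → instr l ≡ choose o t₀ t₁ →
               Run g (position t₀ i st) b₀ → Run g (position t₁ i st) b₁ →
               Run (suc g) (position ((no-push , p , q) , l) i st) (combine o b₀ b₁)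
    popping  : ∀ {g b r f p q l i st} → instr l ≡ pop r f →
               Run (refund (lookup st r) g)
                 (position (f (head (lookup st r))) i (updateAt st r (drop 1))) b →
               Run g (position ((no-push , p , q) , l) i st) b
    reading  : ∀ {g b f p q l i st} → instr l ≡ read f →
               Run g (position (f (head i)) (drop 1 i) st) b →
               Run g (position ((no-push , p , q) , l) i st) b

  refund-mono : ∀ xs {g h} → g ≤ h → refund xs g ≤ refund xs h
  refund-mono []       g≤h = g≤h
  refund-mono (_ ∷ _)  g≤h = s≤s g≤h

  weaken : ∀ {g h c b} → g ≤ h → Run g c b → Run h c b
  weaken (s≤s g≤h) (pushing run)          = pushing (weaken g≤h run)
  weaken g≤h       (halting eq)           = halting eq
  weaken (s≤s g≤h) (choosing eq run run′) = choosing eq (weaken g≤h run) (weaken g≤h run′)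
  weaken g≤h       (popping {r = r} {st = st} eq run) = popping eq (weaken (refund-mono (lookup st r) g≤h) run)
  weaken g≤h       (reading eq run)       = reading eq (weaken g≤h run)

-- Depth-first evaluation of the game by a Turing machine.

-- The Turing machine searches the game tree depth first.  A further tape
-- holds the current play: the choices made so far, each with its player
-- and whether it is the second alternative.  To try a second alternative,
-- everything but this tape is reset and the play is replayed.

module Simulate {Σᵢ : Set} (A : AlternatingMachine Σᵢ) where

  open AlternatingMachine A

  Jump : Set
  Jump = Target #stacks Γ Label

  TapeSymbol : Set
  TapeSymbol = ⊤ ⊎ Γ ⊎ (Bool × Player)

  pattern □            = inj₁ tt
  pattern stacked x    = inj₂ (inj₁ x)
  pattern played s o   = inj₂ (inj₂ (s , o))

  Control : Set
  Control = Jump ⊎ ((Fin #stacks × Γ) × Jump) ⊎ Bool ⊎ ⊤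

  pattern running t    = inj₁ t
  pattern filling p t  = inj₂ (inj₁ (p , t))
  pattern returning b  = inj₂ (inj₂ (inj₁ b))
  pattern resetting    = inj₂ (inj₂ (inj₂ tt))

  Push-finite : Finite (Push #stacks Γ)
  Push-finite = ⊤-finite ⊎-finite (Fin-finite ×-finite symbols)

  Target-finite : Finite Jump
  Target-finite = (Push-finite ×-finite Push-finite ×-finite Push-finite) ×-finite labels

  Control-finite : Finite Control
  Control-finite = Target-finite ⊎-finite ((Fin-finite ×-finite symbols) ×-finite Target-finite)
                   ⊎-finite Bool-finite ⊎-finite ⊤-finite

  TapeSymbol-finite : Finite TapeSymbol
  TapeSymbol-finite = ⊤-finite ⊎-finite symbols ⊎-finite (Bool-finite ×-finite Bool-finite)

  TapeOp : Set
  TapeOp = TapeSymbol → TapeSymbol × Move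

  keep : TapeOp
  keep c = c , stay

  go : Move → TapeOp
  go m c = c , m

  put : TapeSymbol → Move → TapeOp
  put c m _ = c , m

  pattern play     = zero
  pattern stack r  = suc r

  onPlay : TapeOp → Fin (suc #stacks) → TapeOp
  onPlay o play      = o
  onPlay o (stack _) = keep

  onStack : Fin #stacks → TapeOp → Fin (suc #stacks) → TapeOp
  onStack r o play       = keep
  onStack r o (stack r′) = if does (r Fin.≟ r′) then o else keep

  Plan : Set
  Plan = Bool ⊎ (Control × Move × (Fin (suc #stacks) → TapeOp))

  Scanned : Set
  Scanned = Fin (suc #stacks) → TapeSymbol

  -- One rule serves both exploring and replaying: a choice recorded under the head is followed, and
  -- a blank there means that this choice is met for the first time.
  choose-plan : Player → Jump → Jump → TapeSymbol → Plan
  choose-plan o t₀ t₁ (played false _) = inj₂ (running t₀ , stay , onPlay (go right))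
  choose-plan o t₀ t₁ (played true  _) = inj₂ (running t₁ , stay , onPlay (go right))
  choose-plan o t₀ t₁ _                = inj₂ (running t₀ , stay , onPlay (put (played false o) right))

  pop-plan : Fin #stacks → (Maybe Γ → Jump) → TapeSymbol → Plan
  pop-plan r f (stacked x) = inj₂ (running (f (just x)) , stay , onStack r (put □ left))
  pop-plan r f _           = inj₂ (running (f nothing)  , stay , λ _ → keep)

  read-plan : (Maybe Σᵢ → Jump) → Cell Σᵢ → Plan
  read-plan f (sym s) = inj₂ (running (f (just s)) , right , λ _ → keep)
  read-plan f _       = inj₂ (running (f nothing)  , stay  , λ _ → keep)

  instr-plan : Instr Σᵢ Label Γ #stacks → Cell Σᵢ → Scanned → Plan
  instr-plan (halt b)         i h = inj₂ (returning b , stay , onPlay (go left))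
  instr-plan (choose o t₀ t₁) i h = choose-plan o t₀ t₁ (h play)
  instr-plan (pop r f)        i h = pop-plan r f (h (stack r))
  instr-plan (read f)         i h = read-plan f i

  -- A first alternative won by the player who chose settles the choice. Otherwise the second
  -- alternative alone decides, so its value is passed up unchanged and the outcome of the first
  -- need not be stored.
  return-plan : Bool → TapeSymbol → Plan
  return-plan b (played false o) =
    if does (o Bool.≟ b)
    then inj₂ (returning b , stay , onPlay (put □ left))
    else inj₂ (resetting , left , onPlay (put (played true o) left))
  return-plan b (played true _)  = inj₂ (returning b , stay , onPlay (put □ left))
  return-plan b _                = inj₁ b

  -- During a reset the cells in use are not blank and the bottom cell of each tape is, so local
  -- inspection shows whether all heads have come home.
  data Initial : Cell Σᵢ → Scanned → Set where
    initially : ∀ {h} → (∀ j → h j ≡ □) → Initial ⊢ h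

  □? : (c : TapeSymbol) → Dec (c ≡ □)
  □? □           = yes refl
  □? (stacked _) = no λ ()
  □? (played _ _) = no λ ()

  initial? : ∀ i h → Dec (Initial i h)
  initial? ⊢ h with Fin.all? (λ j → □? (h j))
  ... | yes p = yes (initially p)
  ... | no ¬p = no λ { (initially p) → ¬p p }
  initial? ⊣ h = no λ ()
  initial? (sym _) h = no λ ()

  clear : TapeOp
  clear (stacked _) = □ , left
  clear c           = c , stay

  rewind : TapeOp
  rewind □ = □ , stay
  rewind c = c , left

  resetOp : Fin (suc #stacks) → TapeOp
  resetOp play      = rewind
  resetOp (stack _) = clear

  start : Jump
  start = goto entry

  reset-plan : ∀ {i h} → Dec (Initial i h) → Plan
  reset-plan (yes _) = inj₂ (running start , right , onPlay (go right))
  reset-plan (no _)  = inj₂ (resetting , left , resetOp)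

  plan : Control → Cell Σᵢ → Scanned → Plan
  plan (running ((r ◂ x , p , q) , l)) i h =
    inj₂ (filling (r , x) ((p , q , no-push) , l) , stay , onStack r (go right))
  plan (running ((no-push , p , q) , l))  i h = instr-plan (instr l) i h
  plan (filling (r , x) t)             i h = inj₂ (running t , stay , onStack r (put x′ stay))
    where x′ = stacked x
  plan (returning b)                   i h = return-plan b (h play)
  plan resetting                       i h = reset-plan (initial? i h)

  -- The machine accepts if the Refuter wins.

  action : Vec TapeSymbol (suc #stacks) → Plan → Action Control TapeSymbol (suc #stacks)
  action hs (inj₁ b)            = halt (not b)
  action hs (inj₂ (q , m , op)) = continue q m (tabulate λ j → op j (lookup hs j))

  machine : Machine Σᵢ
  machine = record
    { State    = Control
    ; ∣State∣  = proj₁ Control-finite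
    ; finState = proj₂ Control-finite
    ; Γ        = TapeSymbol
    ; ∣Γ∣      = proj₁ TapeSymbol-finite
    ; finΓ     = proj₂ TapeSymbol-finite
    ; 2≤∣Γ∣    = +-monoʳ-≤ 1 (≤-trans (s≤s z≤n) (m≤n+m 4 (proj₁ symbols)))
    ; #tapes   = suc #stacks
    ; start    = resetting
    ; blank    = □
    ; δ        = λ q i hs → action hs (plan q i (lookup hs))
    }

  open Machine machine using (Config; initial; step; _↦_; _↦*_; Outputs; bits; RunsInSpace)

  -- Tape layouts and their sizes.

  -- The blank at the far left is the cell where the head started. It is never overwritten and marks
  -- the bottom. The head of a stack tape rests on the top symbol (`onTop`); that of the play tape
  -- rests one cell further (`afterTop`), where the next choice is recorded or looked up.
  cells : ∀ {X : Set} → (X → TapeSymbol) → List X → List TapeSymbol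
  cells f xs = map f xs ++ [ □ ]

  at : List TapeSymbol → List TapeSymbol → Tape TapeSymbol
  at ls []       = tape ls □ []
  at ls (r ∷ rs) = tape ls r rs

  onTop : ∀ {X : Set} → (X → TapeSymbol) → List X → List TapeSymbol → Tape TapeSymbol
  onTop f []       rs = tape [] □ rs
  onTop f (x ∷ xs) rs = tape (cells f xs) (f x) rs

  afterTop : ∀ {X : Set} → (X → TapeSymbol) → List X → List TapeSymbol → Tape TapeSymbol
  afterTop f xs = at (cells f xs)

  right-onTop : ∀ {X : Set} (f : X → TapeSymbol) xs rs →
                workMove □ right (onTop f xs rs) ≡ afterTop f xs rs
  right-onTop f []       []       = refl
  right-onTop f []       (_ ∷ _)  = refl
  right-onTop f (_ ∷ _)  []       = refl
  right-onTop f (_ ∷ _)  (_ ∷ _)  = refl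

  right-at : ∀ ls c rs → workMove □ right (tape ls c rs) ≡ at (c ∷ ls) rs
  right-at ls c []       = refl
  right-at ls c (_ ∷ _)  = refl

  left-cells : ∀ {X : Set} (f : X → TapeSymbol) xs c rs →
               workMove □ left (tape (cells f xs) c rs) ≡ onTop f xs (c ∷ rs)
  left-cells f []       c rs = refl
  left-cells f (_ ∷ _)  c rs = refl

  open Tape using (size)

  size-right : ∀ {n} (t : Tape TapeSymbol) → size t ≤ n → suc (suc (length (Tape.lefts t))) ≤ n →
               size (workMove □ right t) ≤ n
  size-right (tape ls c [])       _  ≤n = ≤-trans (≤-reflexive (cong suc (+-comm (length ls) 1))) ≤n
  size-right (tape ls c (r ∷ rs)) ≤n _  = ≤-trans (≤-reflexive (≡-sym (+-suc (length ls) _))) ≤n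

  size-left-cells : ∀ {X : Set} {n} (f : X → TapeSymbol) xs c rs →
                    size (tape (cells f xs) c rs) ≤ n →
                    size (workMove □ left (tape (cells f xs) c rs)) ≤ n
  size-left-cells f []       c rs ≤n = ≤n
  size-left-cells f (x ∷ xs) c rs ≤n = ≤-trans (≤-reflexive (+-suc (length (cells f xs)) _)) ≤n

  length-cells : ∀ {X : Set} (f : X → TapeSymbol) xs → length (cells f xs) ≡ suc (length xs)
  length-cells f xs = trans (length-++ (map f xs)) (trans (+-comm _ 1) (cong suc (length-map f xs)))

  lefts-onTop : ∀ {X : Set} (f : X → TapeSymbol) xs rs → length (Tape.lefts (onTop f xs rs)) ≡ length xs
  lefts-onTop f []       rs = refl
  lefts-onTop f (_ ∷ xs) rs = length-cells f xs

  blanks : ℕ → List TapeSymbol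
  blanks j = replicate j □

  perform : TapeOp → Tape TapeSymbol → Tape TapeSymbol
  perform op t = workMove □ (proj₂ (op (Tape.head t))) (write (proj₁ (op (Tape.head t))) t)

  step-continue : ∀ {q i ts q′ m as} →
    Machine.δ machine q (Tape.head i) (Vec.map Tape.head ts) ≡ continue q′ m as →
    step (config q i ts) ≡
      inj₂ (config q′ (inputMove m i) (Vec.zipWith (λ (c , m′) t → workMove □ m′ (write c t)) as ts))
  step-continue eq rewrite eq = refl

  step-halt : ∀ {q i ts b} →
    Machine.δ machine q (Tape.head i) (Vec.map Tape.head ts) ≡ halt b →
    step (config q i ts) ≡ inj₁ b
  step-halt eq rewrite eq = refl

  inputAt : List Σᵢ → List Σᵢ → Tape (Cell Σᵢ)
  inputAt pre []         = tape (map sym pre ++ [ ⊢ ]) ⊣ []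
  inputAt pre (s ∷ rest) = tape (map sym pre ++ [ ⊢ ]) (sym s) (map sym rest ++ [ ⊣ ])

  inputBefore : List Σᵢ → List Σᵢ → Tape (Cell Σᵢ)
  inputBefore []        rest = tape [] ⊢ (map sym rest ++ [ ⊣ ])
  inputBefore (s ∷ pre) rest = tape (map sym pre ++ [ ⊢ ]) (sym s) (map sym rest ++ [ ⊣ ])

  left-inputAt : ∀ pre rest → inputMove left (inputAt pre rest) ≡ inputBefore pre rest
  left-inputAt []      []      = refl
  left-inputAt []      (_ ∷ _) = refl
  left-inputAt (_ ∷ _) []      = refl
  left-inputAt (_ ∷ _) (_ ∷ _) = refl

  left-inputBefore : ∀ s pre rest → inputMove left (inputBefore (s ∷ pre) rest) ≡ inputBefore pre (s ∷ rest)
  left-inputBefore s []      rest = refl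
  left-inputBefore s (_ ∷ _) rest = refl

  right-inputBefore : ∀ rest → inputMove right (inputBefore [] rest) ≡ inputAt [] rest
  right-inputBefore []      = refl
  right-inputBefore (_ ∷ _) = refl

  right-inputAt : ∀ s pre rest → inputMove right (inputAt pre (s ∷ rest)) ≡ inputAt (s ∷ pre) rest
  right-inputAt s pre []      = refl
  right-inputAt s pre (_ ∷ _) = refl

  total : Stacks → ℕ
  total st = Vec.sum (Vec.map length st)

  Choice : Set
  Choice = Bool × Player

  choice-cell : Choice → TapeSymbol
  choice-cell (s , o) = played s o

  stack-cell : Γ → TapeSymbol
  stack-cell = stacked

  lookup≤total : ∀ {k} (st : Vec (List Γ) k) r → length (lookup st r) ≤ Vec.sum (Vec.map length st)
  lookup≤total (xs ∷ st) zero    = m≤m+n _ _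
  lookup≤total (xs ∷ st) (suc r) = ≤-trans (lookup≤total st r) (m≤n+m _ (length xs))

  total-push : ∀ {k} (st : Vec (List Γ) k) r {x} →
               Vec.sum (Vec.map length (updateAt st r (x ∷_))) ≡ suc (Vec.sum (Vec.map length st))
  total-push (xs ∷ st) zero    = refl
  total-push (xs ∷ st) (suc r) = trans (cong (length xs +_) (total-push st r)) (+-suc (length xs) _)

  total-pop : ∀ {k} (st : Vec (List Γ) k) r g →
              Vec.sum (Vec.map length (updateAt st r (drop 1))) + refund (lookup st r) g ≡
              Vec.sum (Vec.map length st) + g
  total-pop ([] ∷ st)       zero    g = refl
  total-pop ((x ∷ xs) ∷ st) zero    g = +-suc _ g
  total-pop (xs ∷ st)       (suc r) g =
    trans (+-assoc (length xs) _ _) (trans (cong (length xs +_) (total-pop st r g)) (≡-sym (+-assoc (length xs) _ g)))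

  -- Correctness and space bound of the simulation.

  module Within (x : List Σᵢ) (N : ℕ) where

    -- Besides at most `N` symbols there are two more cells: the blank at the bottom, and the cell
    -- past the last symbol to which the head moves before a push or on which it awaits the next
    -- choice.
    Bound : ℕ
    Bound = suc (suc N)

    work : Config → Fin (suc #stacks) → Tape TapeSymbol
    work c = lookup (Configuration.work c)

    Small : Config → Set
    Small c = ∀ j → size (work c j) ≤ Bound

    _⇝_ : Config → Config → Set
    _⇝_ = Star (λ c c′ → Small c × c ↦ c′)

    Leads : (Config → Set) → Config → Set
    Leads P c = ∃[ c′ ] (c ⇝ c′ × P c′)

    infixl 1 _>>=_

    _>>=_ : ∀ {c} {P Q : Config → Set} → Leads P c → (∀ {c′} → P c′ → Leads Q c′) → Leads Q c
    (c′ , path , p) >>= next = let (c″ , path′ , q) = next p in c″ , path ◅◅ path′ , q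

    TapePred : Set₁
    TapePred = Fin (suc #stacks) → Tape TapeSymbol → Set

    record Matches (q : Control) (i : Tape (Cell Σᵢ)) (P : TapePred) (c : Config) : Set where
      constructor matches
      field
        state≡ : Configuration.state c ≡ q
        input≡ : Configuration.input c ≡ i
        tapes  : ∀ j → P j (work c j) × size (work c j) ≤ Bound

    -- The only place where a continuing machine step is unfolded. Afterwards a step is verified
    -- tape by tape, the size bound travelling with the shape.
    hop : ∀ {q i P c q′ i′ P′ m op} → Matches q i P c →
          plan q (Tape.head i) (lookup (Vec.map Tape.head (Configuration.work c))) ≡ inj₂ (q′ , m , op) →
          inputMove m i ≡ i′ →
          (∀ j t → P j t → size t ≤ Bound → P′ j (perform (op j) t) × size (perform (op j) t) ≤ Bound) →
          Leads (Matches q′ i′ P′) c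
    hop {q} {i} {P} {config .q .i ts} {q′} {i′} {P′} {m} {op} (matches refl refl ps) eq refl f =
      _ , (((λ j → proj₂ (ps j)) , step-continue {q} {i} {ts} (cong (action (Vec.map Tape.head ts)) eq)) ◅ ε) ,
      matches refl refl after
      where
      as = tabulate (λ j → op j (lookup (Vec.map Tape.head ts) j))
      performed : ∀ j → lookup (Vec.zipWith (λ (c , m′) t → workMove □ m′ (write c t)) as ts) j ≡
                        perform (op j) (lookup ts j)
      performed j = trans (lookup-zipWith _ j as ts) (cong (λ (c , m′) → workMove □ m′ (write c (lookup ts j)))
        (trans (lookup∘tabulate (λ j → op j (lookup (Vec.map Tape.head ts) j)) j) (cong (op j) (lookup-map j Tape.head ts))))
      ts′ = Vec.zipWith (λ (c , m′) t → workMove □ m′ (write c t)) as ts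
      after : ∀ j → P′ j (lookup ts′ j) × size (lookup ts′ j) ≤ Bound
      after j = subst (λ t → P′ j t × size t ≤ Bound) (≡-sym (performed j))
                  (f j _ (proj₁ (ps j)) (proj₂ (ps j)))

    -- `ds` are the choices already followed, latest first, and `es` those still to be replayed. The
    -- number of blanks is left open, since visited cells remain part of the tape after being
    -- erased.
    data PlayAt (ds es : List Choice) : Tape TapeSymbol → Set where
      playAt : ∀ j → PlayAt ds es (afterTop choice-cell ds (map choice-cell es ++ blanks j))

    data PlayBefore (ds es : List Choice) : Tape TapeSymbol → Set where
      playBefore : ∀ j → PlayBefore ds es (onTop choice-cell ds (map choice-cell es ++ blanks j))

    data Holds (xs : List Γ) : Tape TapeSymbol → Set where
      holds : ∀ j → Holds xs (onTop stack-cell xs (blanks j))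

    data Opened (xs : List Γ) : Tape TapeSymbol → Set where
      opened : ∀ j → Opened xs (afterTop stack-cell xs (blanks j))

    Tapes : (Tape TapeSymbol → Set) → Stacks → TapePred
    Tapes P st play      = P
    Tapes P st (stack r) = Holds (lookup st r)

    record Simulates (P : Tape TapeSymbol → Set) (i : List Σᵢ → List Σᵢ → Tape (Cell Σᵢ))
                     (q : Control) (rest : List Σᵢ) (st : Stacks) (c : Config) : Set where
      constructor simulates
      field
        {pre}  : List Σᵢ
        whole  : pre ʳ++ rest ≡ x
        match  : Matches q (i pre rest) (Tapes P st) c

    Runs : List Choice → List Choice → Position → Config → Set
    Runs ds es (position t rest st) = Simulates (PlayAt ds es) inputAt (running t) rest st

    -- A push moves a unit from the budget to the stacks, a pop moves it back, and a choice moves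
    -- one to the play tape: every rule of `Run` preserves this sum.
    Fits : ℕ → List Choice → Position → Set
    Fits g ds (position t rest st) = total st + (length ds + g) ≤ N

    Stays : TapeOp → (Tape TapeSymbol → Set) → (Tape TapeSymbol → Set) → Set
    Stays op P P′ = ∀ t → P t → size t ≤ Bound → P′ (perform op t) × size (perform op t) ≤ Bound

    onPlay-stays : ∀ {op P P′ st} → Stays op P P′ →
                   ∀ j → Stays (onPlay op j) (Tapes P st j) (Tapes P′ st j)
    onPlay-stays h play      = h
    onPlay-stays h (stack r) t p s = p , s

    onStack-stays : ∀ {r op P st st′} →
                    Stays op (Holds (lookup st r)) (Holds (lookup st′ r)) →
                    (∀ r′ → r ≢ r′ → lookup st′ r′ ≡ lookup st r′) →
                    ∀ j → Stays (onStack r op j) (Tapes P st j) (Tapes P st′ j)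
    onStack-stays h others play t p s = p , s
    onStack-stays {r} h others (stack r′) t p s with r Fin.≟ r′
    ... | yes refl = h t p s
    ... | no r≢r′ rewrite others r′ r≢r′ = p , s

    keep-stays : ∀ {P st st′} → (∀ r → lookup st′ r ≡ lookup st r) →
                 ∀ j → Stays keep (Tapes P st j) (Tapes P st′ j)
    keep-stays same play      t p s = p , s
    keep-stays same (stack r) t p s rewrite same r = p , s

    open-stays : ∀ {xs} → length xs ≤ N → Stays (go right) (Holds xs) (Opened xs)
    open-stays {xs} ≤N .(onTop stack-cell xs (blanks j)) (holds j) s =
      subst (Opened xs) (≡-sym (right-onTop stack-cell xs (blanks j))) (opened j) ,
      size-right (onTop stack-cell xs (blanks j)) s (s≤s (s≤s (≤-trans (≤-reflexive (lefts-onTop stack-cell xs _)) ≤N)))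

    fill-stays : ∀ {y xs} → Stays (put (stacked y) stay) (Opened xs) (Holds (y ∷ xs))
    fill-stays ._ (opened zero)    s = holds zero , s
    fill-stays ._ (opened (suc j)) s = holds j , s

    clear-stays : ∀ {xs} → Stays clear (Holds xs) (Holds (drop 1 xs))
    clear-stays {[]}     ._ (holds j) s = holds j , s
    clear-stays {y ∷ xs} ._ (holds j) s =
      subst (Holds xs) (≡-sym (left-cells stack-cell xs □ (blanks j))) (holds (suc j)) ,
      size-left-cells stack-cell xs □ (blanks j) s

    leave-stays : ∀ {ds} → Stays (go left) (PlayAt ds []) (PlayBefore ds [])
    leave-stays {ds} ._ (playAt zero) s =
      subst (PlayBefore ds []) (≡-sym (left-cells choice-cell ds □ [])) (playBefore 1) ,
      size-left-cells choice-cell ds □ [] s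
    leave-stays {ds} ._ (playAt (suc j)) s =
      subst (PlayBefore ds []) (≡-sym (left-cells choice-cell ds □ (blanks j))) (playBefore (suc j)) ,
      size-left-cells choice-cell ds □ (blanks j) s

    room : ∀ {ds} → suc (length ds) ≤ N → suc (suc (length (cells choice-cell ds))) ≤ Bound
    room {ds} ≤N = s≤s (s≤s (≤-trans (≤-reflexive (length-cells choice-cell ds)) ≤N))

    append-stays : ∀ {d ds} → suc (length ds) ≤ N →
                   Stays (put (choice-cell d) right) (PlayAt ds []) (PlayAt (d ∷ ds) [])
    append-stays {d} {ds} ≤N ._ (playAt zero) s =
      playAt zero , size-right (tape (cells choice-cell ds) (choice-cell d) []) s (room {ds} ≤N)
    append-stays {d} {ds} ≤N ._ (playAt (suc j)) s =
      subst (PlayAt (d ∷ ds) []) (≡-sym (right-at _ _ (blanks j))) (playAt j) ,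
      size-right (tape (cells choice-cell ds) (choice-cell d) (blanks j)) s (room {ds} ≤N)

    follow-stays : ∀ {d ds es} → suc (length ds) ≤ N →
                   Stays (go right) (PlayAt ds (d ∷ es)) (PlayAt (d ∷ ds) es)
    follow-stays {d} {ds} {es} ≤N ._ (playAt j) s =
      subst (PlayAt (d ∷ ds) es) (≡-sym (right-at _ _ (map choice-cell es ++ blanks j))) (playAt j) ,
      size-right (tape (cells choice-cell ds) (choice-cell d) (map choice-cell es ++ blanks j)) s (room {ds} ≤N)

    erase-stays : ∀ {d ds} → Stays (put □ left) (PlayBefore (d ∷ ds) []) (PlayBefore ds [])
    erase-stays {d} {ds} ._ (playBefore j) s =
      subst (PlayBefore ds []) (≡-sym (left-cells choice-cell ds □ (blanks j))) (playBefore (suc j)) ,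
      size-left-cells choice-cell ds □ (blanks j) s

    flip-stays : ∀ {d e ds} → Stays (put (choice-cell e) left) (PlayBefore (d ∷ ds) []) (PlayBefore ds [ e ])
    flip-stays {d} {e} {ds} ._ (playBefore j) s =
      subst (PlayBefore ds [ e ]) (≡-sym (left-cells choice-cell ds (choice-cell e) (blanks j))) (playBefore j) ,
      size-left-cells choice-cell ds (choice-cell e) (blanks j) s

    shift : ∀ {X : Set} → List X → List X → List X × List X
    shift []       ys = [] , ys
    shift (x ∷ xs) ys = xs , x ∷ ys

    shift-ʳ++ : ∀ {X : Set} (xs ys : List X) → proj₁ (shift xs ys) ʳ++ proj₂ (shift xs ys) ≡ xs ʳ++ ys
    shift-ʳ++ []       ys = refl
    shift-ʳ++ (x ∷ xs) ys = refl

    length-shift : ∀ {X : Set} {n} (xs ys : List X) → length xs ≤ suc n → length (proj₁ (shift xs ys)) ≤ n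
    length-shift []       ys ≤n       = z≤n
    length-shift (x ∷ xs) ys (s≤s ≤n) = ≤n

    rewind-stays : ∀ {ds es} → Stays rewind (PlayBefore ds es) (PlayBefore (proj₁ (shift ds es)) (proj₂ (shift ds es)))
    rewind-stays {[]}          ._ (playBefore j) s = playBefore j , s
    rewind-stays {d ∷ ds} {es} ._ (playBefore j) s =
      subst (PlayBefore ds (d ∷ es)) (≡-sym (left-cells choice-cell ds (choice-cell d) (map choice-cell es ++ blanks j))) (playBefore j) ,
      size-left-cells choice-cell ds (choice-cell d) (map choice-cell es ++ blanks j) s

    enter-stays : ∀ {es} → Stays (go right) (PlayBefore [] es) (PlayAt [] es)
    enter-stays {es} ._ (playBefore j) s =
      subst (PlayAt [] es) (≡-sym (right-at [] □ (map choice-cell es ++ blanks j))) (playAt j) ,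
      size-right (tape [] □ (map choice-cell es ++ blanks j)) s (s≤s (s≤s z≤n))

    scanned : ∀ {q i P c} → Matches q i P c → ∀ j {s} → (∀ t → P j t → Tape.head t ≡ s) →
              lookup (Vec.map Tape.head (Configuration.work c)) j ≡ s
    scanned {c = c} m j h = trans (lookup-map j Tape.head (Configuration.work c)) (h _ (proj₁ (Matches.tapes m j)))

    scanned-top : ∀ {y xs} t → Holds (y ∷ xs) t → Tape.head t ≡ stacked y
    scanned-top ._ (holds j) = refl

    scanned-bottom : ∀ t → Holds [] t → Tape.head t ≡ □
    scanned-bottom ._ (holds j) = refl

    scanned-fresh : ∀ {ds} t → PlayAt ds [] t → Tape.head t ≡ □
    scanned-fresh ._ (playAt zero)    = refl
    scanned-fresh ._ (playAt (suc j)) = refl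

    scanned-choice : ∀ {d ds es} t → PlayAt ds (d ∷ es) t → Tape.head t ≡ choice-cell d
    scanned-choice ._ (playAt j) = refl

    scanned-last : ∀ {d ds es} t → PlayBefore (d ∷ ds) es t → Tape.head t ≡ choice-cell d
    scanned-last ._ (playBefore j) = refl

    scanned-start : ∀ {es} t → PlayBefore [] es t → Tape.head t ≡ □
    scanned-start ._ (playBefore j) = refl

    plan-instr : ∀ {l I i h} → instr l ≡ I → instr-plan (instr l) i h ≡ instr-plan I i h
    plan-instr {i = i} {h} = cong (λ I → instr-plan I i h)

    simulate-push : ∀ {ds es r y p q l rest st c} → length (lookup st r) ≤ N →
      Runs ds es (position ((r ◂ y , p , q) , l) rest st) c →
      Leads (Runs ds es (position ((p , q , no-push) , l) rest (push r y st))) c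
    simulate-push {ds} {es} {r} {y} {st = st} ≤N (simulates w m) =
      hop {P′ = Half} m refl refl opening >>= λ m′ →
      let c , path , m″ = hop m′ refl refl filling-in in c , path , simulates w m″
      where
      -- A push takes two machine steps, as the head must first leave the top symbol; in between,
      -- only tape `r` has its head past the top.
      Half : TapePred
      Half play       = PlayAt ds es
      Half (stack r′) t = (r ≡ r′ × Opened (lookup st r) t) ⊎ (r ≢ r′ × Holds (lookup st r′) t)
      opening : ∀ j → Stays (onStack r (go right) j) (Tapes (PlayAt ds es) st j) (Half j)
      opening play t p s = p , s
      opening (stack r′) t p s with r Fin.≟ r′
      ... | yes refl = let o , s′ = open-stays ≤N t p s in inj₁ (refl , o) , s′
      ... | no r≢r′ = inj₂ (r≢r′ , p) , s
      filling-in : ∀ j → Stays (onStack r (put (stacked y) stay) j) (Half j) (Tapes (PlayAt ds es) (push r y st) j)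
      filling-in play t p s = p , s
      filling-in (stack r′) t p s with r Fin.≟ r′ | p
      ... | yes refl | inj₁ (_ , o) rewrite lookup∘updateAt r {y ∷_} st = fill-stays t o s
      ... | yes refl | inj₂ (r≢r , _) = ⊥-elim (r≢r refl)
      ... | no r≢r′ | inj₁ (r≡r′ , _) = ⊥-elim (r≢r′ r≡r′)
      ... | no r≢r′ | inj₂ (_ , h) rewrite lookup∘updateAt′ r′ r {y ∷_} (r≢r′ ∘ ≡-sym) st = h , s

    simulate-pop : ∀ {ds es r f p q l rest st c} → instr l ≡ pop r f →
      Runs ds es (position ((no-push , p , q) , l) rest st) c →
      Leads (Runs ds es (position (f (head (lookup st r))) rest (updateAt st r (drop 1)))) c
    simulate-pop {ds} {es} {r} {f} {st = st} eq (simulates w m) with lookup st r in top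
    ... | y ∷ ys =
      let c , path , m′ = hop m (trans (plan-instr eq)
                                  (cong (pop-plan r f) (scanned m (stack r) λ t h → scanned-top t (subst (λ z → Holds z t) top h))))
                            refl (onStack-stays {r} {P = PlayAt ds es} {st} popped λ r′ r≢r′ → lookup∘updateAt′ r′ r (r≢r′ ∘ ≡-sym) st)
      in c , path , simulates w m′
      where
      popped : Stays (put □ left) (Holds (lookup st r)) (Holds (lookup (updateAt st r (drop 1)) r))
      popped rewrite lookup∘updateAt r {drop 1} st | top = λ { ._ (holds j) s → clear-stays {y ∷ ys} _ (holds j) s }
    ... | [] =
      let c , path , m′ = hop m (trans (plan-instr eq)
                                  (cong (pop-plan r f) (scanned m (stack r) λ t h → scanned-bottom t (subst (λ z → Holds z t) top h))))
                            refl (keep-stays {P = PlayAt ds es} {st} unchanged)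
      in c , path , simulates w m′
      where
      unchanged : ∀ r′ → lookup (updateAt st r (drop 1)) r′ ≡ lookup st r′
      unchanged r′ with r Fin.≟ r′
      ... | yes refl = trans (lookup∘updateAt r st) (trans (cong (drop 1) top) (≡-sym top))
      ... | no r≢r′ = lookup∘updateAt′ r′ r (r≢r′ ∘ ≡-sym) st

    simulate-read : ∀ {ds es f p q l rest st c} → instr l ≡ read f →
      Runs ds es (position ((no-push , p , q) , l) rest st) c →
      Leads (Runs ds es (position (f (head rest)) (drop 1 rest) st)) c
    simulate-read {ds} {es} {rest = []} {st} eq (simulates w m) =
      let c , path , m′ = hop m (plan-instr eq) refl (keep-stays {P = PlayAt ds es} {st} λ _ → refl)
      in c , path , simulates w m′
    simulate-read {ds} {es} {rest = y ∷ rest} {st} eq (simulates {pre} w m) =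
      let c , path , m′ = hop m (plan-instr eq) (right-inputAt y pre rest) (keep-stays {P = PlayAt ds es} {st} λ _ → refl)
      in c , path , simulates w m′

    Ready : List Choice → Config → Set
    Ready es = Runs [] es (position start x empty)

    head-blank : ∀ {q i P c} → Matches q i P c →
                 (∀ j → lookup (Vec.map Tape.head (Configuration.work c)) j ≡ □) →
                 ∀ j → Σ[ t ∈ Tape TapeSymbol ] (P j t × Tape.head t ≡ □)
    head-blank {c = c} m all j =
      work c j , proj₁ (Matches.tapes m j) , trans (≡-sym (lookup-map j Tape.head (Configuration.work c))) (all j)

    blank-stack : ∀ {xs} → Σ[ t ∈ Tape TapeSymbol ] (Holds xs t × Tape.head t ≡ □) → xs ≡ []
    blank-stack {[]}    _                   = refl
    blank-stack {_ ∷ _} (_ , holds j , ())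

    blank-play : ∀ {ds es} → Σ[ t ∈ Tape TapeSymbol ] (PlayBefore ds es t × Tape.head t ≡ □) → ds ≡ []
    blank-play {[]}    _                        = refl
    blank-play {_ ∷ _} (_ , playBefore j , ())

    length≤0 : ∀ {X : Set} (xs : List X) → length xs ≤ 0 → xs ≡ []
    length≤0 [] _ = refl

    -- `n` bounds the distance of every head from home. A resetting step shortens all nonzero
    -- distances at once while the heads already home wait, and at distance zero the test for
    -- `Initial` cannot fail.
    reset : ∀ n {ds es rest st c} → length ds ≤ n → (∀ r → length (lookup st r) ≤ n) →
            (sim : Simulates (PlayBefore ds es) inputBefore resetting rest st c) →
            length (Simulates.pre sim) ≤ n → Leads (Ready (ds ʳ++ es)) c
    reset n {ds} {es} {rest} {st} {c} ds≤ st≤ (simulates {pre} w m) pre≤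
      with initial? (Tape.head (inputBefore pre rest)) (lookup (Vec.map Tape.head (Configuration.work c))) in eq
    reset n {ds} {es} {rest} {st} {c} ds≤ st≤ (simulates {s ∷ pre} w m) pre≤ | yes ()
    reset n {ds} {es} {rest} {st} {c} ds≤ st≤ (simulates {[]} refl m) pre≤ | yes (initially all)
      with refl ← blank-play (head-blank m all play) =
      let c , path , m′ = hop m (cong reset-plan eq) (right-inputBefore rest) stays in c , path , simulates refl m′
      where
      stays : ∀ j → Stays (onPlay (go right) j) (Tapes (PlayBefore [] es) st j) (Tapes (PlayAt [] es) empty j)
      stays play = enter-stays
      stays (stack r) t h s =
        subst (λ xs → Holds xs t)
          (trans (blank-stack (head-blank m all (stack r))) (≡-sym (lookup-replicate r []))) h , s
    reset zero {ds} {es} {rest} {st} {c} ds≤ st≤ (simulates {pre} w m) pre≤ | no ¬i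
      with refl ← length≤0 pre pre≤ | refl ← length≤0 ds ds≤ = ⊥-elim (¬i (initially blank))
      where
      blank : ∀ j → lookup (Vec.map Tape.head (Configuration.work c)) j ≡ □
      blank play      = scanned m play scanned-start
      blank (stack r) = scanned m (stack r)
        λ t h → scanned-bottom t (subst (λ xs → Holds xs t) (length≤0 _ (st≤ r)) h)
    reset (suc n) {ds} {es} {rest} {st} {c} ds≤ st≤ (simulates {pre} w m) pre≤ | no ¬i =
      hop m (cong reset-plan eq) (left-input pre) stays >>= λ m′ →
      subst (λ z → Leads (Ready z) _) (shift-ʳ++ ds es)
        (reset n (length-shift ds es ds≤) shorter (simulates (trans (shift-ʳ++ pre rest) w) m′) (length-shift pre rest pre≤))
      where
      left-input : ∀ pre → inputMove left (inputBefore pre rest) ≡ inputBefore (proj₁ (shift pre rest)) (proj₂ (shift pre rest))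
      left-input []        = refl
      left-input (s ∷ pre) = left-inputBefore s pre rest
      stays : ∀ j → Stays (resetOp j) (Tapes (PlayBefore ds es) st j)
                      (Tapes (PlayBefore (proj₁ (shift ds es)) (proj₂ (shift ds es))) (Vec.map (drop 1) st) j)
      stays play = rewind-stays
      stays (stack r) rewrite lookup-map r (drop 1) st = clear-stays
      shorter : ∀ r → length (lookup (Vec.map (drop 1) st) r) ≤ n
      shorter r rewrite lookup-map r (drop 1) st with lookup st r | st≤ r
      ... | []     | _      = z≤n
      ... | _ ∷ _  | s≤s ≤n = ≤n

    Returned : Bool → List Choice → Config → Set
    Returned b ds c = ∃[ rest ] ∃[ st ] Simulates (PlayBefore ds []) inputAt (returning b) rest st c

    -- The induction carries the way back to the current position as a function. It is quantified
    -- over the remaining choices `es`, so that it can be extended by one step at each choice met on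
    -- the way down.
    Replays : List Choice → Position → Set
    Replays ds p = ∀ es {c} → Ready (ds ʳ++ es) c → Leads (Runs ds es p) c

    simulate-halt : ∀ {ds b p q l rest st c} → instr l ≡ halt b →
      Runs ds [] (position ((no-push , p , q) , l) rest st) c → Leads (Returned b ds) c
    simulate-halt {st = st} eq (simulates w m) =
      let c , path , m′ = hop m (plan-instr eq) refl (onPlay-stays {st = st} leave-stays)
      in c , path , _ , st , simulates w m′

    simulate-first : ∀ {ds o t₀ t₁ p q l rest st c} → suc (length ds) ≤ N → instr l ≡ choose o t₀ t₁ →
      Runs ds [] (position ((no-push , p , q) , l) rest st) c →
      Leads (Runs ((false , o) ∷ ds) [] (position t₀ rest st)) c
    simulate-first {o = o} {t₀} {t₁} {st = st} ≤N eq (simulates w m) =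
      let c , path , m′ = hop m (trans (plan-instr eq)
                                  (cong (choose-plan o t₀ t₁) (scanned m play scanned-fresh)))
                            refl (onPlay-stays {st = st} (append-stays ≤N))
      in c , path , simulates w m′

    simulate-again : ∀ {ds es s o t₀ t₁ p q l rest st c} → suc (length ds) ≤ N → instr l ≡ choose o t₀ t₁ →
      Runs ds ((s , o) ∷ es) (position ((no-push , p , q) , l) rest st) c →
      Leads (Runs ((s , o) ∷ ds) es (position (if s then t₁ else t₀) rest st)) c
    simulate-again {s = s} {o} {t₀} {t₁} {st = st} ≤N eq (simulates w m) =
      let c , path , m′ = hop m (trans (plan-instr eq)
                                  (trans (cong (choose-plan o t₀ t₁) (scanned m play scanned-choice)) (follow s)))
                            refl (onPlay-stays {st = st} (follow-stays ≤N))
      in c , path , simulates w m′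
      where
      follow : ∀ s → choose-plan o t₀ t₁ (played s o) ≡
                     inj₂ (running (if s then t₁ else t₀) , stay , onPlay (go right))
      follow false = refl
      follow true  = refl

    erase : ∀ {b d ds c} → return-plan b (choice-cell d) ≡ inj₂ (returning b , stay , onPlay (put □ left)) →
            Returned b (d ∷ ds) c → Leads (Returned b ds) c
    erase {b} eq (rest , st , simulates w m) =
      let c , path , m′ = hop m (trans (cong (return-plan b) (scanned m play scanned-last)) eq)
                            refl (onPlay-stays {st = st} erase-stays)
      in c , path , rest , st , simulates w m′

    retry : ∀ {b o ds c} →
      return-plan b (played false o) ≡ inj₂ (resetting , left , onPlay (put (played true o) left)) →
      Returned b ((false , o) ∷ ds) c → Leads (Ready (ds ʳ++ [ true , o ])) c
    retry {b} {o} {ds} eq (rest , st , simulates {pre} w m) =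
      hop m (trans (cong (return-plan b) (scanned m play scanned-last)) eq)
        (left-inputAt pre rest) (onPlay-stays {st = st} flip-stays) >>= λ m′ →
      reset (length ds + (total st + length pre))
        (m≤m+n (length ds) _)
        (λ r → ≤-trans (lookup≤total st r) (≤-trans (m≤m+n _ (length pre)) (m≤n+m _ (length ds))))
        (simulates w m′)
        (≤-trans (m≤n+m (length pre) (total st)) (m≤n+m _ (length ds)))

    explore : ∀ {g p b} → Run g p b → ∀ ds → Fits g ds p → Replays ds p →
              ∀ {c} → Runs ds [] p c → Leads (Returned b ds) c
    explore (pushing {g} {r = r} {x = y} {st = st} run) ds fits replays sim =
      go-on sim >>= explore run ds fits′ (λ es ready → replays es ready >>= go-on)
      where
      fits′ : total (push r y st) + (length ds + g) ≤ N
      fits′ = ≤-trans (≤-reflexive (trans (cong (_+ (length ds + g)) (total-push st r))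
                (trans (≡-sym (+-suc (total st) _)) (cong (total st +_) (≡-sym (+-suc (length ds) g)))))) fits
      go-on : ∀ {es c} → Runs ds es _ c → Leads (Runs ds es _) c
      go-on = simulate-push (≤-trans (lookup≤total st r) (≤-trans (m≤m+n _ _) fits))
    explore (halting eq) ds fits replays sim = simulate-halt eq sim
    explore (popping {g} {r = r} {st = st} eq run) ds fits replays sim =
      simulate-pop eq sim >>= explore run ds fits′ (λ es ready → replays es ready >>= simulate-pop eq)
      where
      open ≡-Reasoning
      swap : ∀ a b c → a + (b + c) ≡ b + (a + c)
      swap a b c = trans (≡-sym (+-assoc a b c)) (trans (cong (_+ c) (+-comm a b)) (+-assoc b a c))
      fits′ : total (updateAt st r (drop 1)) + (length ds + refund (lookup st r) g) ≤ N
      fits′ = ≤-trans (≤-reflexive (begin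
        total (updateAt st r (drop 1)) + (length ds + refund (lookup st r) g) ≡⟨ swap (total (updateAt st r (drop 1))) (length ds) (refund (lookup st r) g) ⟩
        length ds + (total (updateAt st r (drop 1)) + refund (lookup st r) g) ≡⟨ cong (length ds +_) (total-pop st r g) ⟩
        length ds + (total st + g)                                           ≡⟨ swap (length ds) (total st) g ⟩
        total st + (length ds + g)                                           ∎)) fits
    explore (reading eq run) ds fits replays sim =
      simulate-read eq sim >>= explore run ds fits (λ es ready → replays es ready >>= simulate-read eq)
    explore (choosing {g} {b₀} {b₁} {o} {t₀} {t₁} {i = rest} {st = st} eq run₀ run₁) ds fits replays sim =
      simulate-first ≤N eq sim >>= λ sim₀ →
      explore run₀ ((false , o) ∷ ds) fits′ (again false) sim₀ >>= resolve o b₀ refl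
      where
      fits′ : total st + (suc (length ds) + g) ≤ N
      fits′ = ≤-trans (≤-reflexive (cong (total st +_) (≡-sym (+-suc (length ds) g)))) fits
      ≤N : suc (length ds) ≤ N
      ≤N = ≤-trans (m≤m+n (suc (length ds)) g) (≤-trans (m≤n+m _ (total st)) fits′)
      again : ∀ s → Replays ((s , o) ∷ ds) (position (if s then t₁ else t₀) rest st)
      again s es ready = replays ((s , o) ∷ es) ready >>= simulate-again ≤N eq
      second : ∀ {c} → Ready (ds ʳ++ [ true , o ]) c → Leads (Returned b₁ ds) c
      second ready = again true [] ready >>= λ sim₁ →
        explore run₁ ((true , o) ∷ ds) fits′ (again true) sim₁ >>= erase refl
      -- Player and first outcome are made variables so that `combine` and `return-plan` compute in
      -- each case; the equation reconnects `retry` with `second`.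
      resolve : ∀ o′ b → o′ ≡ o → ∀ {c} → Returned b ((false , o′) ∷ ds) c → Leads (Returned (combine o′ b b₁) ds) c
      resolve Verifier true  _    returned = erase refl returned
      resolve Refuter  false _    returned = erase refl returned
      resolve Verifier false refl returned = retry refl returned >>= second
      resolve Refuter  true  refl returned = retry refl returned >>= second

    size-replicate : ∀ {k} r → size (lookup (Vec.replicate k (tape {TapeSymbol} [] □ [])) r) ≤ Bound
    size-replicate r rewrite lookup-replicate r (tape {TapeSymbol} [] □ []) = s≤s z≤n

    total-empty : ∀ k → Vec.sum (Vec.map length (Vec.replicate {A = List Γ} k [])) ≡ 0
    total-empty zero    = refl
    total-empty (suc k) = total-empty k

    ready : Leads (Ready []) (initial x)
    ready = reset 0 {[]} {[]} {x} {empty} z≤n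
      (λ r → ≤-reflexive (cong length (lookup-replicate r (List.[] {A = Γ}))))
      (simulates {pre = []} refl (matches refl refl λ
        { play → playBefore 0 , s≤s z≤n
        ; (stack r) → subst (λ xs → Holds xs (lookup (Vec.replicate #stacks (tape [] □ [])) r)) (≡-sym (lookup-replicate r []))
                        (subst (Holds []) (≡-sym (lookup-replicate r (tape [] □ []))) (holds 0)) ,
                      size-replicate r }))
      z≤n

    fits-initially : total empty + (0 + N) ≤ N
    fits-initially = ≤-reflexive (cong (_+ N) (total-empty #stacks))

    stop : ∀ {b rest st c} → Simulates (PlayBefore [] []) inputAt (returning b) rest st c → step c ≡ inj₁ (not b)
    stop {b} {c = config q i ts} (simulates w m@(matches refl refl ps)) =
      step-halt {q} {i} {ts}
        (cong (action (Vec.map Tape.head ts)) (cong (return-plan b) (scanned m play scanned-start)))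

    search : ∀ {b} → Run N (position start x empty) b →
             ∃[ c ] (initial x ⇝ c × step c ≡ inj₁ (not b) × Small c)
    search {b} run
      with c , path , _ , st , sim ← (ready >>= explore run [] fits-initially (λ es sim → _ , ε , sim)) =
      c , path , stop sim , λ j → proj₂ (Matches.tapes (Simulates.match sim) j)

    -- The machine is deterministic and the path ends in a halting configuration, so no reachable
    -- configuration lies off the path.
    reachable-small : ∀ {c d c′ b} → c ⇝ d → step d ≡ inj₁ b → Small d → c ↦* c′ → Small c′
    reachable-small ε                    halted small ε = small
    reachable-small ((small , _) ◅ _)    halted _     ε = small
    reachable-small ε                    halted _     (move ◅ _) with () ← trans (≡-sym halted) move
    reachable-small ((_ , move) ◅ path) halted small (move′ ◅ path′)
      with refl ← trans (≡-sym move) move′ = reachable-small path halted small path′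

    forget : ∀ {c d} → c ⇝ d → c ↦* d
    forget ε                   = ε
    forget ((_ , move) ◅ path) = move ◅ forget path

    sum-bound : ∀ {k n} (ts : Vec (Tape TapeSymbol) k) → (∀ j → size (lookup ts j) ≤ n) →
                Vec.sum (Vec.map size ts) ≤ k * n
    sum-bound []       small = z≤n
    sum-bound (t ∷ ts) small = +-mono-≤ (small zero) (sum-bound ts (small ∘ suc))

  tape-bits : ℕ
  tape-bits = suc #stacks * ⌈log₂ proj₁ TapeSymbol-finite ⌉

  simulation : ∀ {x N b} → Run N (position start x empty) b →
               Outputs x (not b) × RunsInSpace x (tape-bits * suc (suc N))
  simulation {x} {N} run with c , path , halted , small ← Within.search x N run =
    (c , forget path , halted) ,
    λ c′ path′ → ≤-trans
      (*-monoˡ-≤ ⌈log₂ proj₁ TapeSymbol-finite ⌉ (sum-bound (Configuration.work c′) (reachable-small path halted small path′)))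
      (≤-reflexive (swap (suc #stacks) (suc (suc N)) ⌈log₂ proj₁ TapeSymbol-finite ⌉))
    where
    open Within x N
    swap : ∀ a b c → a * b * c ≡ a * c * b
    swap a b c = trans (*-assoc a b c) (trans (cong (a *_) (*-comm b c)) (≡-sym (*-assoc a c b)))

-- Signed formulas and their semantics.

-- `⊘` demands nothing. It disposes of the argument not chosen when an implication is split, and as
-- the sign of antecedents for CK it lets both logics share one game.
data Sign : Set where
  ⊕ ⊖ ⊘ : Sign

antecedent-sign : Bool → Sign
antecedent-sign true  = ⊕
antecedent-sign false = ⊘

-- A set of signed formulas, in which the conditionals and the variables
-- met so far have been set apart.

record Sequent : Set where
  constructor sequent
  field
    todo     : List (Sign × Formula)
    holding  : List (Formula × Formula)
    failing  : List (Formula × Formula)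
    literals : List (Bool × ATM)

goals : List (Sign × Formula) → Sequent
goals todo = sequent todo [] [] []

Compatible : Bool × ATM → Bool × ATM → Set
Compatible (s , p) (s′ , q) = p ≡ q → s ≡ s′

module Semantics (M : Model) where

  open Model M

  _⊨_ : W → Sign × Formula → Set
  w ⊨ (⊕ , A) = ⟦ A ⟧ w
  w ⊨ (⊖ , A) = ¬ ⟦ A ⟧ w
  w ⊨ (⊘ , A) = ⊤

  _⊨ℓ_ : W → Bool × ATM → Set
  w ⊨ℓ (true  , p) = val p w
  w ⊨ℓ (false , p) = ¬ val p w

  record _⊨ˢ_ (w : W) (s : Sequent) : Set where
    constructor satisfies
    open Sequent s
    field
      on-todo     : All (w ⊨_) todo
      on-holding  : All (λ (A , B) → ⟦ A ⇒ B ⟧ w) holding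
      on-failing  : All (λ (A , B) → ¬ ⟦ A ⇒ B ⟧ w) failing
      on-literals : All (w ⊨ℓ_) literals

-- Reduction of satisfiability to smaller sets of signed formulas.

-- Both logics at once: the models of the logic satisfy the frame
-- condition if reflexive is true.

module Logic (em : ExcludedMiddle 0ℓ) (reflexive : Bool) where

  Admissible : Model → Set
  Admissible M = reflexive ≡ true → Model.SatisfiesID M

  Satisfiable : Sequent → Set₁
  Satisfiable s = Σ[ M ∈ Model ] (Admissible M × (∃[ w ] Semantics._⊨ˢ_ M w s))

  Apart : Formula → Formula → Set₁
  Apart A C = Satisfiable (goals ((⊖ , C) ∷ (⊕ , A) ∷ [])) ⊎ Satisfiable (goals ((⊕ , C) ∷ (⊖ , A) ∷ []))

  -- A world selected for a failing C ⇒ E must satisfy the consequents of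
  -- the holding conditionals A ⇒ B with A equivalent to C.  Taking more
  -- of them than necessary only makes the requirement stronger, so
  -- equivalence need not be verified, only its negation.

  Selectable : Formula → List (Formula × Formula) → List (Sign × Formula) → Set₁
  Selectable C []                  todo = Satisfiable (goals ((antecedent-sign reflexive , C) ∷ todo))
  Selectable C ((A , B) ∷ holding) todo =
    Selectable C holding ((⊕ , B) ∷ todo) ⊎
    (Selectable C holding todo × Satisfiable (goals ((⊖ , C) ∷ (⊕ , A) ∷ []))) ⊎
    (Selectable C holding todo × Satisfiable (goals ((⊕ , C) ∷ (⊖ , A) ∷ [])))

  Realizable : List (Formula × Formula) → Formula × Formula → Set₁
  Realizable holding (C , E) = Selectable C holding ((⊖ , E) ∷ [])

  decide : (P : Set) → Dec P
  decide P = em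

  by-contradiction : {P : Set} → ¬ ¬ P → P
  by-contradiction {P} ¬¬p with decide P
  ... | yes p = p
  ... | no ¬p = ⊥-elim (¬¬p ¬p)

  module Necessity {M : Model} (admissible : Admissible M) where

    open Model M
    open Semantics M

    witness : ∀ {P Q : Pred W 0ℓ} → ¬ (P ⊆ Q) → ∃[ u ] (P u × ¬ Q u)
    witness P⊈Q = by-contradiction λ none → P⊈Q λ {u} p → by-contradiction λ ¬q → none (u , p , ¬q)

    apart : ∀ A C → ¬ (⟦ A ⟧ ≐ ⟦ C ⟧) → Apart A C
    apart A C A≢C with decide (∃[ u ] (⟦ A ⟧ u × ¬ ⟦ C ⟧ u))
    ... | yes (u , a , ¬c) = inj₁ (M , admissible , u , satisfies (¬c ∷ a ∷ []) [] [] [])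
    ... | no none with witness {⟦ C ⟧} {⟦ A ⟧} (λ C⊆A → A≢C ((λ {u} a → by-contradiction λ ¬c → none (u , a , ¬c)) , C⊆A))
    ...   | u , c , ¬a = inj₂ (M , admissible , u , satisfies (c ∷ ¬a ∷ []) [] [] [])

    -- Everything is read off from the given model: if `A` and `C` have the same extension there,
    -- `f-cong` places `u` among the worlds selected for `A`, so `B` holds at `u`; if not, the model
    -- itself separates them.
    selectable : ∀ {w u C todo} holding → f w ⟦ C ⟧ u → All (λ (A , B) → ⟦ A ⇒ B ⟧ w) holding →
                 All (u ⊨_) todo → Selectable C holding todo
    selectable {w} {u} {C} [] fu [] hs = M , admissible , u , satisfies (antecedent reflexive (λ eq → admissible eq w C fu) ∷ hs) [] [] []
      where
      antecedent : ∀ b → (b ≡ true → ⟦ C ⟧ u) → u ⊨ (antecedent-sign b , C)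
      antecedent true  c = c refl
      antecedent false _ = tt
    selectable {w} {u} {C} ((A , B) ∷ holding) fu (h ∷ hs) us with decide (⟦ A ⟧ ≐ ⟦ C ⟧)
    ... | yes A≐C = inj₁ (selectable holding fu hs (h (proj₂ (f-cong w A≐C) fu) ∷ us))
    ... | no A≢C with apart A C A≢C
    ...   | inj₁ sat = inj₂ (inj₁ (selectable holding fu hs us , sat))
    ...   | inj₂ sat = inj₂ (inj₂ (selectable holding fu hs us , sat))

    realizable : ∀ {w} holding → All (λ (A , B) → ⟦ A ⇒ B ⟧ w) holding →
                 ∀ failing → All (λ (A , B) → ¬ ⟦ A ⇒ B ⟧ w) failing → All (Realizable holding) failing
    realizable holding hs []            []       = []
    realizable holding hs ((C , E) ∷ failing) (¬h ∷ ¬hs) with witness ¬h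
    ... | u , fu , ¬e = selectable holding fu hs (¬e ∷ []) ∷ realizable holding hs failing ¬hs

    compatible : ∀ {w} {x y} → w ⊨ℓ x → w ⊨ℓ y → Compatible x y
    compatible {x = true  , _} {true  , _} _ _ _    = refl
    compatible {x = false , _} {false , _} _ _ _    = refl
    compatible {x = true  , _} {false , _} p ¬p refl = ⊥-elim (¬p p)
    compatible {x = false , _} {true  , _} ¬p p refl = ⊥-elim (¬p p)

    all-compatible : ∀ {w} v → All (w ⊨ℓ_) v → AllPairs Compatible v
    all-compatible []      []       = []
    all-compatible (x ∷ v) (h ∷ hs) = All.map (compatible h) hs ∷ all-compatible v hs

  _agrees-with_on_ : Formula → Formula → Model → Set
  A agrees-with C on M = Model.⟦_⟧ M A ≐ Model.⟦_⟧ M C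

  -- The implication in `on-holding` treats both ways of dealing with a holding conditional alike:
  -- if its consequent was included, `M′` is `M` and the conclusion is true; if it was excluded,
  -- `M′` refutes the premise.
  record Selected (C : Formula) (holding : List (Formula × Formula)) (todo : List (Sign × Formula)) : Set₁ where
    field
      M          : Model
      admissible : Admissible M
      u          : Model.W M
      on-todo    : All (Semantics._⊨_ M u) ((antecedent-sign reflexive , C) ∷ todo)
      on-holding : All (λ (A , B) → Σ[ M′ ∈ Model ] (Admissible M′ × (A agrees-with C on M′ → Model.⟦_⟧ M B u))) holding

  differs : ∀ {A C} → Apart A C → Σ[ M ∈ Model ] (Admissible M × ¬ (A agrees-with C on M))
  differs (inj₁ (M , adm , u , Semantics.satisfies (¬c ∷ a ∷ []) _ _ _)) = M , adm , λ (A⊆C , _) → ¬c (A⊆C a)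
  differs (inj₂ (M , adm , u , Semantics.satisfies (c ∷ ¬a ∷ []) _ _ _)) = M , adm , λ (_ , C⊆A) → ¬a (C⊆A c)

  selected : ∀ {C} holding {todo} → Selectable C holding todo → Selected C holding todo
  selected [] (M , adm , u , Semantics.satisfies hs _ _ _) =
    record { M = M ; admissible = adm ; u = u ; on-todo = hs ; on-holding = [] }
  selected ((A , B) ∷ holding) (inj₁ sel) with selected holding sel
  ... | record { M = M ; admissible = adm ; u = u ; on-todo = c ∷ b ∷ hs ; on-holding = bs } =
    record { M = M ; admissible = adm ; u = u ; on-todo = c ∷ hs ; on-holding = (M , adm , λ _ → b) ∷ bs }
  selected {C} ((A , B) ∷ holding) {todo} (inj₂ sel) = join sel
    where
    without : Apart A C → Selectable C holding todo → Selected C ((A , B) ∷ holding) todo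
    without apart sel = let open Selected (selected holding sel) ; M′ , adm′ , A≢C = differs apart in
      record { M = M ; admissible = admissible ; u = u ; on-todo = on-todo
             ; on-holding = (M′ , adm′ , λ A≐C → ⊥-elim (A≢C A≐C)) ∷ on-holding }
    join : _ → Selected C ((A , B) ∷ holding) todo
    join (inj₁ (sel , sat)) = without (inj₁ sat) sel
    join (inj₂ (sel , sat)) = without (inj₂ sat) sel

  -- The model consists of a new world, the root, and a disjoint union of
  -- components.  At the root, f selects for a set P the worlds realizing
  -- those failing C ⇒ E for which P and C agree on all components: C
  -- itself need not be evaluated at the root, so this is not circular.

  module Sufficiency {holding failing : List (Formula × Formula)} {literals : List (Bool × ATM)}
    (compatible : AllPairs Compatible literals)
    (select : ∀ {C E} → (C , E) ∈ failing → Selected C holding ((⊖ , E) ∷ [])) where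

    -- For each failing conditional, the world realizing it and, for each
    -- holding A ⇒ B, a model where A and C differ if B fails at that world.

    Index : Set
    Index = Σ[ (C , E) ∈ Formula × Formula ] ((C , E) ∈ failing × Maybe (Σ[ x ∈ Formula × Formula ] x ∈ holding))

    component : Index → Model
    component (_ , o∈ , nothing)       = Selected.M (select o∈)
    component (_ , o∈ , just (_ , i∈)) = proj₁ (All.lookup (Selected.on-holding (select o∈)) i∈)

    component-admissible : ∀ j → Admissible (component j)
    component-admissible (_ , o∈ , nothing)       = Selected.admissible (select o∈)
    component-admissible (_ , o∈ , just (_ , i∈)) = proj₁ (proj₂ (All.lookup (Selected.on-holding (select o∈)) i∈))

    Worlds : Set
    Worlds = Maybe (Σ[ j ∈ Index ] Model.W (component j))

    pattern root     = nothing
    pattern inside j u = just (j , u)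

    restrict : Pred Worlds 0ℓ → ∀ j → Pred (Model.W (component j)) 0ℓ
    restrict P j u = P (inside j u)

    Matching : Pred Worlds 0ℓ → Formula → Set
    Matching P C = ∀ j → restrict P j ≐ Model.⟦_⟧ (component j) C

    select-worlds : Worlds → Pred Worlds 0ℓ → Pred Worlds 0ℓ
    select-worlds root         P w = ∃[ C ] ∃[ E ] Σ[ o∈ ∈ (C , E) ∈ failing ]
      (Matching P C × w ≡ inside (_ , o∈ , nothing) (Selected.u (select o∈)))
    select-worlds (inside j u) P w = ∃[ u′ ] (Model.f (component j) u (restrict P j) u′ × w ≡ inside j u′)

    restrict-cong : ∀ {P Q} → P ≐ Q → ∀ j → restrict P j ≐ restrict Q j
    restrict-cong (P⊆Q , Q⊆P) j = P⊆Q , Q⊆P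

    ≐-trans : ∀ {X : Set} {P Q R : Pred X 0ℓ} → P ≐ Q → Q ≐ R → P ≐ R
    ≐-trans (P⊆Q , Q⊆P) (Q⊆R , R⊆Q) = Q⊆R ∘ P⊆Q , Q⊆P ∘ R⊆Q

    ≐-sym : ∀ {X : Set} {P Q : Pred X 0ℓ} → P ≐ Q → Q ≐ P
    ≐-sym (P⊆Q , Q⊆P) = Q⊆P , P⊆Q

    select-mono : ∀ w {P Q} → P ≐ Q → select-worlds w P ⊆ select-worlds w Q
    select-mono root         P≐Q (C , E , o∈ , P≐C , eq) =
      C , E , o∈ , (λ j → ≐-trans (restrict-cong (≐-sym P≐Q) j) (P≐C j)) , eq
    select-mono (inside j u) P≐Q (u′ , fu , eq) =
      u′ , proj₁ (Model.f-cong (component j) u (restrict-cong P≐Q j)) fu , eq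

    valuation : ATM → Pred Worlds 0ℓ
    valuation p root         = (true , p) ∈ literals
    valuation p (inside j u) = Model.val (component j) p u

    model : Model
    model = record
      { W      = Worlds
      ; w₀     = root
      ; f      = select-worlds
      ; f-cong = λ w P≐Q → select-mono w P≐Q , select-mono w (≐-sym P≐Q)
      ; val    = valuation
      }

    open Model model using (⟦_⟧)
    open Semantics model

    -- A world inside a component selects only worlds of that component, so each component is a
    -- generated submodel; `f-cong` exchanges the restricted extension for the one computed in the
    -- component.
    truth : ∀ A → Matching ⟦ A ⟧ A
    truth (var p) j = id , id
    truth ⊥′      j = id , id
    truth (A ⟶ B) j with truth A j | truth B j
    ... | A⊆ , A⊇ | B⊆ , B⊇ =
      (λ { (inj₁ ¬a) → inj₁ (¬a ∘ A⊇) ; (inj₂ b) → inj₂ (B⊆ b) }) ,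
      (λ { (inj₁ ¬a) → inj₁ (¬a ∘ A⊆) ; (inj₂ b) → inj₂ (B⊇ b) })
    truth (A ⇒ B) j with truth B j
    ... | B⊆ , B⊇ =
      (λ {u} h fu → B⊆ (h (_ , proj₂ (Model.f-cong (component j) u (truth A j)) fu , refl))) ,
      (λ {u} h (u′ , fu , eq) → subst ⟦ B ⟧ (≡-sym eq) (B⊇ (h (proj₁ (Model.f-cong (component j) u (truth A j)) fu))))

    -- A world selected at the root satisfies `C` because of its sign `⊕`, and matching on the
    -- component of that very world turns this into `A`.
    admissible : Admissible model
    admissible eq root         A (C , E , o∈ , A≐C , refl) =
      proj₂ (A≐C (_ , o∈ , nothing)) (antecedent reflexive eq (Selected.on-todo (select o∈)))
      where
      antecedent : ∀ b → b ≡ true → All (Semantics._⊨_ _ _) ((antecedent-sign b , C) ∷ _) → Model.⟦_⟧ (Selected.M (select o∈)) C (Selected.u (select o∈))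
      antecedent .true refl (c ∷ _) = c
    admissible eq (inside j u) A (u′ , fu , refl) =
      proj₂ (truth A j) (component-admissible j eq u A (proj₁ (Model.f-cong (component j) u (truth A j)) fu))

    -- Matching is required on all components, in particular on the one kept for this pair of
    -- conditionals, where agreement of `A` and `C` implies `B` at the selected world.
    holds-at-root : ∀ {A B} → (A , B) ∈ holding → ⟦ A ⇒ B ⟧ root
    holds-at-root {A} {B} i∈ (C , E , o∈ , A≐C , refl) =
      proj₂ (truth B (_ , o∈ , nothing))
        (proj₂ (proj₂ (All.lookup (Selected.on-holding (select o∈)) i∈))
          (≐-trans (≐-sym (truth A (_ , o∈ , just (_ , i∈)))) (A≐C (_ , o∈ , just (_ , i∈)))))

    fails-at-root : ∀ {C E} → (C , E) ∈ failing → ¬ ⟦ C ⇒ E ⟧ root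
    fails-at-root {C} {E} o∈ h with Selected.on-todo (select o∈)
    ... | _ ∷ ¬e ∷ [] = ¬e (proj₁ (truth E (_ , o∈ , nothing)) (h (C , E , o∈ , truth C , refl)))

    opposite : ∀ {v p} → AllPairs Compatible v → (true , p) ∈ v → ¬ (false , p) ∈ v
    opposite (xs ∷ _) (here refl) (there q) with () ← All.lookup xs q refl
    opposite (xs ∷ _) (there p) (here refl) with () ← All.lookup xs p refl
    opposite (_ ∷ c)  (there p) (there q) = opposite c p q

    literals-at-root : ∀ {x} → x ∈ literals → root ⊨ℓ x
    literals-at-root {true  , p} x∈ = x∈
    literals-at-root {false , p} x∈ p∈ = opposite compatible p∈ x∈

    satisfiable : Satisfiable (sequent [] holding failing literals)
    satisfiable = model , admissible , root ,
      satisfies [] (All.tabulate holds-at-root) (All.tabulate fails-at-root) (All.tabulate literals-at-root)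

  Realized : Sequent → Set₁
  Realized (sequent _ holding failing literals) = AllPairs Compatible literals × All (Realizable holding) failing

  satisfiable⇒realized : ∀ {holding failing literals} → let s = sequent [] holding failing literals in
                         Satisfiable s → Realized s
  satisfiable⇒realized (M , adm , w , Semantics.satisfies _ hs ¬hs ls) =
    Necessity.all-compatible adm _ ls , Necessity.realizable adm _ hs _ ¬hs

  realized⇒satisfiable : ∀ {holding failing literals} → let s = sequent [] holding failing literals in
                         Realized s → Satisfiable s
  realized⇒satisfiable {holding} (compatible , realizable) =
    Sufficiency.satisfiable compatible (λ o∈ → selected holding (All.lookup realizable o∈))

-- The game as a program on six stacks.

-- The marks say what to do with the next formula: evaluate it with a sign,
-- ignore it, or move it to a stack of conditionals, writing a separator
-- first if it is stored.

Mark : Set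
Mark = Bool ⊎ ⊤ ⊎ Bool ⊎ Bool

Letter : Set
Letter = Bool ⊎ Bool ⊎ Bit ⊎ Mark

Alphabet : Set
Alphabet = ⊤ ⊎ Letter

pattern ♯         = inj₁ tt
pattern letter x  = inj₂ x
pattern ‵⊥        = letter (inj₁ false)
pattern ‵atom     = letter (inj₁ true)
pattern op c      = letter (inj₂ (inj₁ c))
pattern ‵→        = op false
pattern ‵⇒        = op true
pattern ‵digit d  = letter (inj₂ (inj₂ (inj₁ d)))
pattern mark m    = letter (inj₂ (inj₂ (inj₂ m)))
pattern signed b  = mark (inj₁ b)
pattern ignored   = mark (inj₂ (inj₁ tt))
pattern copied b  = mark (inj₂ (inj₂ (inj₁ b)))
pattern stored b  = mark (inj₂ (inj₂ (inj₂ b)))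

Mark-finite : Finite Mark
Mark-finite = Bool-finite ⊎-finite ⊤-finite ⊎-finite Bool-finite ⊎-finite Bool-finite

Alphabet-finite : Finite Alphabet
Alphabet-finite = ⊤-finite ⊎-finite Bool-finite ⊎-finite Bool-finite ⊎-finite Fin-finite ⊎-finite Mark-finite

Comparable : Set
Comparable = Bool ⊎ Bit

Label : Set
Label = Fin 8 ⊎ Fin 9 ⊎ Fin 8 ⊎ Fin 8 ⊎ (Fin 8 × Bool) ⊎ Comparable

pattern load                 = inj₁ 0F
pattern close                = inj₁ 1F
pattern main                 = inj₁ 2F
pattern split                = inj₁ 3F
pattern ignore               = inj₁ 4F
pattern literal              = inj₁ 5F
pattern win                  = inj₁ 6F
pattern lose                 = inj₁ 7F
pattern world-end            = inj₂ (inj₁ 0F)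
pattern first                = inj₂ (inj₁ 1F)
pattern skip-first           = inj₂ (inj₁ 2F)
pattern mark-first           = inj₂ (inj₁ 3F)
pattern second               = inj₂ (inj₁ 4F)
pattern skip-second          = inj₂ (inj₁ 5F)
pattern mark-second          = inj₂ (inj₁ 6F)
pattern compare              = inj₂ (inj₁ 7F)
pattern compare-end          = inj₂ (inj₁ 8F)
pattern clear-literals       = inj₂ (inj₂ (inj₁ 0F))
pattern pick                 = inj₂ (inj₂ (inj₁ 1F))
pattern pass-antecedent      = inj₂ (inj₂ (inj₁ 2F))
pattern pass-consequent      = inj₂ (inj₂ (inj₁ 3F))
pattern take-antecedent      = inj₂ (inj₂ (inj₁ 4F))
pattern take-consequent      = inj₂ (inj₂ (inj₁ 5F))
pattern clear-failing        = inj₂ (inj₂ (inj₁ 6F))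
pattern restore              = inj₂ (inj₂ (inj₁ 7F))
pattern next                 = inj₂ (inj₂ (inj₂ (inj₁ 0F)))
pattern decide-next          = inj₂ (inj₂ (inj₂ (inj₁ 1F)))
pattern include              = inj₂ (inj₂ (inj₂ (inj₁ 2F)))
pattern take-consequent′     = inj₂ (inj₂ (inj₂ (inj₁ 3F)))
pattern exclude              = inj₂ (inj₂ (inj₂ (inj₁ 4F)))
pattern accept               = inj₂ (inj₂ (inj₂ (inj₁ 5F)))
pattern drop-consequent      = inj₂ (inj₂ (inj₂ (inj₁ 6F)))
pattern finish               = inj₂ (inj₂ (inj₂ (inj₁ 7F)))
pattern on-sign b            = inj₂ (inj₂ (inj₂ (inj₂ (inj₁ (0F , b)))))
pattern copy b               = inj₂ (inj₂ (inj₂ (inj₂ (inj₁ (1F , b)))))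
pattern exclude-by b         = inj₂ (inj₂ (inj₂ (inj₂ (inj₁ (2F , b)))))
pattern challenge b          = inj₂ (inj₂ (inj₂ (inj₂ (inj₁ (3F , b)))))
pattern clear-formulas b     = inj₂ (inj₂ (inj₂ (inj₂ (inj₁ (4F , b)))))
pattern take-antecedent′ b   = inj₂ (inj₂ (inj₂ (inj₂ (inj₁ (5F , b)))))
pattern clear-holding b      = inj₂ (inj₂ (inj₂ (inj₂ (inj₁ (6F , b)))))
pattern finish-challenge b   = inj₂ (inj₂ (inj₂ (inj₂ (inj₁ (7F , b)))))
pattern compare-with u       = inj₂ (inj₂ (inj₂ (inj₂ (inj₂ u))))

Label-finite : Finite Label
Label-finite = Fin-finite ⊎-finite Fin-finite ⊎-finite Fin-finite ⊎-finite Fin-finite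
               ⊎-finite (Fin-finite ×-finite Bool-finite) ⊎-finite Bool-finite ⊎-finite Fin-finite

-- `signs` has one mark for each formula on `formulas`; during loading it is the operator stack.
-- Once a failing conditional has been taken, `failings` holds only its antecedent.
pattern formulas  = 0F
pattern signs     = 1F
pattern holdings  = 2F
pattern failings  = 3F
pattern scratch   = 4F
pattern literals′ = 5F

conditionals : Bool → Fin 6
conditionals true  = holdings
conditionals false = failings

signed-mark : Sign → Alphabet
signed-mark ⊕ = signed true
signed-mark ⊖ = signed false
signed-mark ⊘ = ignored

comparable : Comparable → Alphabet
comparable (inj₁ b) = signed b
comparable (inj₂ d) = ‵digit d

same : Comparable → Alphabet → Bool
same (inj₁ b) (signed b′) = does (b Bool.≟ b′)
same (inj₂ d) (‵digit d′) = does (d Fin.≟ d′)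
same _        _           = false

module _ (reflexive : Bool) where

  antecedent-mark : Alphabet
  antecedent-mark = signed-mark (antecedent-sign reflexive)

  Instr₆ : Set
  Instr₆ = Instr Symbol Label Alphabet 6

  pattern push₁ r x l           = ((r ◂ x) , no-push , no-push) , l
  pattern push₂ r x r′ x′ l     = ((r ◂ x) , (r′ ◂ x′) , no-push) , l

  program : Label → Instr₆
  -- Infix is converted as in the shunting-yard algorithm: operators wait on `signs` until their
  -- closing parenthesis.
  program load = read λ
    { nothing          → push₁ signs (signed false) main
    ; (just falsum)    → push₁ formulas ‵⊥ load
    ; (just imp)       → push₁ signs ‵→ load
    ; (just cond)      → push₁ signs ‵⇒ load
    ; (just lpar)      → goto load
    ; (just rpar)      → goto close
    ; (just atom)      → push₁ formulas ‵atom load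
    ; (just (digit d)) → push₁ formulas (‵digit d) load }
  program close = pop signs λ
    { (just x) → push₁ formulas x load
    ; nothing  → goto load }
  program main = pop signs λ
    { nothing           → goto world-end
    ; (just (signed b)) → goto (on-sign b)
    ; (just ignored)    → goto ignore
    ; (just (copied b)) → goto (copy b)
    ; (just (stored b)) → push₁ (conditionals b) ♯ (copy b)
    ; (just _)          → goto win }
  program (on-sign b) = pop formulas λ
    { (just ‵⊥)         → goto (if b then lose else main)
    ; (just ‵→)         → if b then goto split else push₂ signs (signed true) signs (signed false) main
    ; (just ‵⇒)         → push₂ signs (stored b) signs (stored b) main
    ; (just ‵atom)      → push₂ formulas ‵atom literals′ (signed b) literal
    ; (just (‵digit d)) → push₂ formulas (‵digit d) literals′ (signed b) literal
    ; _                 → goto win }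
  program split = choose Verifier (push₂ signs (signed false) signs ignored main)
                                (push₂ signs ignored signs (signed true) main)
  program literal = pop formulas λ
    { (just (‵digit d)) → push₁ literals′ (‵digit d) literal
    ; _                 → goto main }
  program ignore = pop formulas λ
    { (just (‵digit d)) → goto ignore
    ; (just (op c))     → push₁ signs ignored ignore
    ; _                 → goto main }
  program (copy b) = pop formulas λ
    -- Two formulas follow an operator. The mark postpones the second, so `signs` doubles as the
    -- recursion stack.
    { (just (op c))     → push₂ (conditionals b) (op c) signs (copied b) (copy b)
    ; (just (‵digit d)) → push₁ (conditionals b) (‵digit d) (copy b)
    ; (just x)          → push₁ (conditionals b) x main
    ; nothing           → goto win }
  program win  = halt true
  program lose = halt false

  program world-end = choose Refuter (goto first) (goto clear-literals)
  -- The Refuter exhibits a clash by marking two literals, one after the other; running past the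
  -- last one loses.
  program first = choose Refuter (goto skip-first) (goto mark-first)
  program skip-first = pop literals′ λ
    { (just (‵digit d)) → goto skip-first
    ; (just (signed b)) → goto first
    ; _                 → goto win }
  program mark-first = pop literals′ λ
    { (just (‵digit d)) → push₁ formulas (‵digit d) mark-first
    ; (just (signed b)) → push₁ formulas (signed b) second
    ; _                 → goto win }
  program second = choose Refuter (goto skip-second) (goto mark-second)
  program skip-second = pop literals′ λ
    { (just (‵digit d)) → goto skip-second
    ; (just (signed b)) → goto second
    ; _                 → goto win }
  program mark-second = pop literals′ λ
    { (just (‵digit d)) → push₁ scratch (‵digit d) mark-second
    ; (just (signed b)) → push₁ scratch (signed (not b)) compare
    ; _                 → goto win }
  program compare = pop scratch λ
    { nothing           → goto compare-end
    ; (just (‵digit d)) → goto (compare-with (inj₂ d))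
    ; (just (signed b)) → goto (compare-with (inj₁ b))
    ; _                 → goto win }
  program (compare-with u) = pop formulas λ
    { (just x) → goto (if same u x then compare else win)
    ; nothing  → goto win }
  program compare-end = pop formulas λ
    { (just _) → goto win
    ; nothing  → goto lose }

  program clear-literals = pop literals′ λ
    { (just _) → goto clear-literals
    ; nothing  → goto pick }
  program pick = choose Refuter (goto pass-antecedent) (goto take-antecedent)
  program pass-antecedent = pop failings λ
    { (just ♯) → goto pass-consequent
    ; (just _) → goto pass-antecedent
    ; nothing  → goto win }
  program pass-consequent = pop failings λ
    { (just ♯) → goto pick
    ; (just _) → goto pass-consequent
    ; nothing  → goto win }
  -- The antecedent covers everything that has to be removed from `failings`, so it waits on
  -- `scratch` meanwhile.
  program take-antecedent = pop failings λ
    { (just ♯) → goto take-consequent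
    ; (just x) → push₁ scratch x take-antecedent
    ; nothing  → goto win }
  program take-consequent = pop failings λ
    { (just ♯) → push₁ signs (signed false) clear-failing
    ; (just x) → push₁ formulas x take-consequent
    ; nothing  → goto win }
  program clear-failing = pop failings λ
    { (just _) → goto clear-failing
    ; nothing  → goto restore }
  program restore = pop scratch λ
    { (just x) → push₁ failings x restore
    ; nothing  → goto next }

  program next = pop holdings λ
    { (just x) → push₁ holdings x decide-next
    ; nothing  → goto finish }
  program decide-next = choose Verifier (goto include) (goto exclude)
  program include = pop holdings λ
    { (just ♯) → goto take-consequent′
    ; (just _) → goto include
    ; nothing  → goto win }
  program take-consequent′ = pop holdings λ
    { (just ♯) → push₁ signs (signed true) next
    ; (just x) → push₁ formulas x take-consequent′
    ; nothing  → goto win }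
  -- The Verifier commits to a direction of the inequivalence before the Refuter either accepts or
  -- challenges it. A challenge abandons the rest of the position, so the claim is tested without a
  -- second copy of anything.
  program exclude = choose Verifier (goto (exclude-by true)) (goto (exclude-by false))
  program (exclude-by b) = choose Refuter (goto accept) (goto (challenge b))
  program accept = pop holdings λ
    { (just ♯) → goto drop-consequent
    ; (just _) → goto accept
    ; nothing  → goto win }
  program drop-consequent = pop holdings λ
    { (just ♯) → goto next
    ; (just _) → goto drop-consequent
    ; nothing  → goto win }
  program finish = pop failings λ
    { (just x) → push₁ formulas x finish
    ; nothing  → push₁ signs antecedent-mark main }

  program (challenge b) = pop signs λ
    { (just _) → goto (challenge b)
    ; nothing  → goto (clear-formulas b) }
  program (clear-formulas b) = pop formulas λ
    { (just _) → goto (clear-formulas b)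
    ; nothing  → goto (take-antecedent′ b) }
  program (take-antecedent′ b) = pop holdings λ
    { (just ♯) → push₁ signs (signed b) (clear-holding b)
    ; (just x) → push₁ formulas x (take-antecedent′ b)
    ; nothing  → goto win }
  program (clear-holding b) = pop holdings λ
    { (just _) → goto (clear-holding b)
    ; nothing  → goto (finish-challenge b) }
  program (finish-challenge b) = pop failings λ
    { (just x) → push₁ formulas x (finish-challenge b)
    ; nothing  → push₁ signs (signed (not b)) main }

  prover : AlternatingMachine Symbol
  prover = record
    { Label   = Label
    ; Γ       = Alphabet
    ; #stacks = 6
    ; labels  = Label-finite
    ; symbols = Alphabet-finite
    ; entry   = load
    ; instr   = program
    }

-- Encodings on the stacks and cost measures.

reflects-map : ∀ {p q : Level} {P : Set p} {Q : Set q} {b} → (P → Q) → (Q → P) → Reflects P b → Reflects Q b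
reflects-map to from (ofʸ p)  = ofʸ (to p)
reflects-map to from (ofⁿ ¬p) = ofⁿ λ q → ¬p (from q)

digits : ATM → List Bit
digits i = proj₁ (toDigits 2 i)

digits-injective : ∀ {i j} → digits i ≡ digits j → i ≡ j
digits-injective {i} {j} eq = trans (≡-sym (proj₂ (toDigits 2 i))) (trans (cong fromDigits eq) (proj₂ (toDigits 2 j)))

digit-letter : Bit → Alphabet
digit-letter d = ‵digit d

-- Reversed infix without parentheses, that is, prefix notation with the
-- arguments swapped; the digits of a variable come before its atom.

encode : Formula → List Alphabet → List Alphabet
encode (var i) m = map digit-letter (digits i) ʳ++ (‵atom ∷ m)
encode ⊥′      m = ‵⊥ ∷ m
encode (A ⟶ B) m = ‵→ ∷ encode B (encode A m)
encode (A ⇒ B) m = ‵⇒ ∷ encode B (encode A m)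

-- What `encode` turns into when popped symbol by symbol onto another stack: ordinary postfix
-- notation.
encodeʳ : Formula → List Alphabet → List Alphabet
encodeʳ (var i) k = ‵atom ∷ (map digit-letter (digits i) ++ k)
encodeʳ ⊥′      k = ‵⊥ ∷ k
encodeʳ (A ⟶ B) k = encodeʳ A (encodeʳ B (‵→ ∷ k))
encodeʳ (A ⇒ B) k = encodeʳ A (encodeʳ B (‵⇒ ∷ k))

encode-todo : List (Sign × Formula) → List Alphabet
encode-todo []            = []
encode-todo ((_ , A) ∷ t) = encode A (encode-todo t)

encode-signs : List (Sign × Formula) → List Alphabet
encode-signs []            = []
encode-signs ((s , _) ∷ t) = signed-mark s ∷ encode-signs t

encode-pairs : List (Formula × Formula) → List Alphabet
encode-pairs []            = []
encode-pairs ((A , B) ∷ k) = encodeʳ A (♯ ∷ encodeʳ B (♯ ∷ encode-pairs k))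

encode-literals : List (Bool × ATM) → List Alphabet
encode-literals []            = []
encode-literals ((b , i) ∷ v) = map digit-letter (digits i) ++ signed b ∷ encode-literals v

operators : Formula → ℕ
operators (var _) = 0
operators ⊥′      = 0
operators (A ⟶ B) = suc (operators B + operators A)
operators (A ⇒ B) = suc (operators B + operators A)

-- A variable weighs 1 whatever its index: its digits already lie on a stack and are only moved or
-- erased. The 5 of an operator exceeds by one the 4 of a pair in `weights`, so setting a
-- conditional apart lowers the cost strictly.
⟪_⟫ : Formula → ℕ
⟪ var _ ⟫ = 1
⟪ ⊥′ ⟫    = 1
⟪ A ⟶ B ⟫ = 5 + (⟪ B ⟫ + ⟪ A ⟫)
⟪ A ⇒ B ⟫ = 5 + (⟪ B ⟫ + ⟪ A ⟫)

weight : List (Sign × Formula) → ℕ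
weight []            = 0
weight ((_ , A) ∷ t) = ⟪ A ⟫ + weight t

-- The 4 leaves room for the three choices that a holding pair can occasion: `decide-next`,
-- `exclude` and `exclude-by`.
weights : List (Formula × Formula) → ℕ
weights []            = 0
weights ((A , B) ∷ k) = 4 + (⟪ A ⟫ + ⟪ B ⟫) + weights k

cost : Sequent → ℕ
cost (sequent t p n v) = 6 + (weight t + (weights p + weights n))

operators≤⟪⟫ : ∀ A → operators A ≤ ⟪ A ⟫
operators≤⟪⟫ (var _) = z≤n
operators≤⟪⟫ ⊥′      = z≤n
operators≤⟪⟫ (A ⟶ B) = s≤s (m≤n⇒m≤o+n 4 (+-mono-≤ (operators≤⟪⟫ B) (operators≤⟪⟫ A)))
operators≤⟪⟫ (A ⇒ B) = s≤s (m≤n⇒m≤o+n 4 (+-mono-≤ (operators≤⟪⟫ B) (operators≤⟪⟫ A)))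

by-excess : ∀ {m n} k → n ≡ k + m → m ≤ n
by-excess k refl = m≤n+m _ k

-- The first `n` is for the loaded formula, 1 for its sign, and the rest bounds the cost of the
-- initial position.
work-space : ℕ → ℕ
work-space n = n + (1 + (6 + 5 * n))

linear-in-O : ∀ k → O (λ n → n * ⌊log₂ n ⌋) (λ n → k * (2 + work-space n))
-- The threshold is 2 because `⌊log₂ 1 ⌋` is 0.
linear-in-O k = k * 15 , 2 , λ n 2≤n → begin
  k * (2 + work-space n)   ≤⟨ *-monoʳ-≤ k (linear n 2≤n) ⟩
  k * (15 * n)             ≡⟨ *-assoc k 15 n ⟨
  k * 15 * n               ≡⟨ cong (k * 15 *_) (*-identityʳ n) ⟨
  k * 15 * (n * 1)         ≤⟨ *-monoʳ-≤ (k * 15) (*-monoʳ-≤ n (⌊log₂⌋-mono-≤ 2≤n)) ⟩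
  k * 15 * (n * ⌊log₂ n ⌋) ∎
  where
  open ≤-Reasoning
  expand : ∀ n → 15 * (2 + n) ≡ (9 * n + 9) + (2 + ((2 + n) + (1 + (6 + 5 * (2 + n)))))
  expand = solve-∀
  linear : ∀ n → 2 ≤ n → 2 + work-space n ≤ 15 * n
  linear (suc zero)    (s≤s ())
  linear (suc (suc n)) _ = by-excess (9 * n + 9) (expand n)

-- Runs of the program and their outcomes.

module Correctness (em : ExcludedMiddle 0ℓ) (reflexive : Bool) where

  open Logic em reflexive
  open AlternatingMachine (prover reflexive)

  state : _ → (m s p n c v : List Alphabet) → Position
  state l m s p n c v = position (goto l) [] (m ∷ s ∷ p ∷ n ∷ c ∷ v ∷ [])

  module _ {g : ℕ} {b : Bool} where

    pour : (C : List Alphabet → List Alphabet → Position) → ∀ ds {m k} →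
           (∀ d {xs ys} → Run g (C xs (‵digit d ∷ ys)) b → Run g (C (‵digit d ∷ xs) ys) b) →
           Run g (C m (map digit-letter ds ʳ++ k)) b → Run g (C (map digit-letter ds ++ m) k) b
    pour C []       step run = run
    pour C (d ∷ ds) step run = step d (pour C ds step run)

    pourʳ : (C : List Alphabet → List Alphabet → Position) → ∀ ds {m k} →
            (∀ d {xs ys} → Run g (C xs (‵digit d ∷ ys)) b → Run g (C (‵digit d ∷ xs) ys) b) →
            Run g (C m (map digit-letter ds ++ k)) b → Run g (C (map digit-letter ds ʳ++ m) k) b
    pourʳ C []       step run = run
    pourʳ C (d ∷ ds) step run = pourʳ C ds step (step d run)

    -- Runs are built from their end, so the hypothesis is the position after the move. The budget
    -- stays the same because each pop pays for the push that follows.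
    module Transfer (C : List Alphabet → List Alphabet → Position)
                (step : ∀ x {xs ys} → Run g (C xs (letter x ∷ ys)) b → Run g (C (letter x ∷ xs) ys) b) where

      stack : ∀ A {m k} → Run g (C m (encodeʳ A k)) b → Run g (C (encode A m) k) b
      stack (var i) run = pourʳ C (digits i) (λ d → step _) (step _ run)
      stack ⊥′      run = step _ run
      stack (A ⟶ B) run = step _ (stack B (stack A run))
      stack (A ⇒ B) run = step _ (stack B (stack A run))

      unstack : ∀ A {m k} → Run g (C k (encode A m)) b → Run g (C (encodeʳ A k) m) b
      unstack (var i) run = step _ (pour C (digits i) (λ d → step _) run)
      unstack ⊥′      run = step _ run
      unstack (A ⟶ B) run = unstack A (unstack B (step _ run))
      unstack (A ⇒ B) run = unstack A (unstack B (step _ run))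

    -- Discarding is a transfer in a context that ignores the receiving stack.
    discard : (C : List Alphabet → Position) →
              (∀ x {xs} → Run (suc g) (C xs) b → Run g (C (letter x ∷ xs)) b) →
              ∀ A {k} → Run g (C k) b → Run g (C (encodeʳ A k)) b
    discard C step A {k} = Transfer.unstack (λ xs _ → C xs) (λ x run → step x (weaken (n≤1+n g) run)) A {[]} {k}

    clear : (C : List Alphabet → Position) →
            (∀ x {xs} → Run (suc g) (C xs) b → Run g (C (x ∷ xs)) b) →
            ∀ xs → Run g (C []) b → Run g (C xs) b
    clear C step []       run = run
    clear C step (x ∷ xs) run = step x (weaken (n≤1+n g) (clear C step xs run))

  ignore-formula : ∀ A {g b m s p n c v} → Run g (state main m s p n c v) b → Run g (state ignore (encode A m) s p n c v) b
  ignore-formula (var i) {s = s} {p} {n} {c} {v} run = pourʳ (λ m _ → state ignore m s p n c v) (digits i) {k = []}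
    (λ d run → popping refl (weaken (n≤1+n _) run)) (popping refl (weaken (n≤1+n _) run))
  ignore-formula ⊥′      run = popping refl (weaken (n≤1+n _) run)
  ignore-formula (A ⟶ B) run = popping refl (pushing (ignore-formula B (popping refl (weaken (n≤1+n _) (ignore-formula A run)))))
  ignore-formula (A ⇒ B) run = popping refl (pushing (ignore-formula B (popping refl (weaken (n≤1+n _) (ignore-formula A run)))))

  -- Moving letters is free; the budget is needed for the postponing marks, at most one per
  -- operator.
  copy-holding : ∀ A {g b m s p n c v} → operators A ≤ g →
    Run g (state main m s (encodeʳ A p) n c v) b → Run g (state (copy true) (encode A m) s p n c v) b
  copy-holding (var i) ≤g run = pourʳ (λ m p → state (copy true) m _ p _ _ _) (digits i)
    (λ d run → popping refl (pushing run)) (popping refl (pushing run))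
  copy-holding ⊥′      ≤g run = popping refl (pushing run)
  copy-holding (A ⟶ B) (s≤s ≤g) run = popping refl (pushing (pushing
    (copy-holding B (m+n≤o⇒m≤o _ ≤g) (popping refl (copy-holding A (m≤n⇒m≤1+n (m+n≤o⇒n≤o (operators B) ≤g)) run)))))
  copy-holding (A ⇒ B) (s≤s ≤g) run = popping refl (pushing (pushing
    (copy-holding B (m+n≤o⇒m≤o _ ≤g) (popping refl (copy-holding A (m≤n⇒m≤1+n (m+n≤o⇒n≤o (operators B) ≤g)) run)))))

  copy-failing : ∀ A {g b m s p n c v} → operators A ≤ g →
    Run g (state main m s p (encodeʳ A n) c v) b → Run g (state (copy false) (encode A m) s p n c v) b
  copy-failing (var i) ≤g run = pourʳ (λ m n → state (copy false) m _ _ n _ _) (digits i)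
    (λ d run → popping refl (pushing run)) (popping refl (pushing run))
  copy-failing ⊥′      ≤g run = popping refl (pushing run)
  copy-failing (A ⟶ B) (s≤s ≤g) run = popping refl (pushing (pushing
    (copy-failing B (m+n≤o⇒m≤o _ ≤g) (popping refl (copy-failing A (m≤n⇒m≤1+n (m+n≤o⇒n≤o (operators B) ≤g)) run)))))
  copy-failing (A ⇒ B) (s≤s ≤g) run = popping refl (pushing (pushing
    (copy-failing B (m+n≤o⇒m≤o _ ≤g) (popping refl (copy-failing A (m≤n⇒m≤1+n (m+n≤o⇒n≤o (operators B) ≤g)) run)))))

  data Variable : List Alphabet → Set where
    of-atom  : ∀ {xs} → Variable (‵atom ∷ xs)
    of-digit : ∀ {d xs} → Variable (‵digit d ∷ xs)

  variable-encode : ∀ ds {xs} → Variable xs → Variable (map digit-letter ds ʳ++ xs)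
  variable-encode []       h = h
  variable-encode (d ∷ ds) h = variable-encode ds of-digit

  store-literal : ∀ sign i {g b m s p n c v} →
    Run g (state main m s p n c (map digit-letter (digits i) ++ signed sign ∷ v)) b →
    Run (suc g) (state (on-sign sign) (encode (var i) m) s p n c v) b
  store-literal sign i {m = m} {s} {p} {n} {c} {v} run =
    enter (variable-encode (digits i) of-atom)
      (pourʳ (λ m v → state literal m s p n c v) (digits i) (λ d run → popping refl (pushing run))
        (popping refl (weaken (n≤1+n _) run)))
    where
    enter : ∀ {g b xs} → Variable xs → Run g (state literal xs s p n c (signed sign ∷ v)) b →
            Run (suc g) (state (on-sign sign) xs s p n c v) b
    enter of-atom  run = popping refl (pushing (pushing run))
    enter of-digit run = popping refl (pushing (pushing run))

  HasOutcome : ∀ {p} → ℕ → Position → Set p → Set p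
  HasOutcome g pos P = ∃[ b ] (Run g pos b × Reflects P b)

  infixr 0 _after_

  _after_ : ∀ {p} {P : Set p} {g h pos pos′} → (∀ {b} → Run g pos b → Run h pos′ b) →
            HasOutcome g pos P → HasOutcome h pos′ P
  f after (b , run , r) = b , f run , r

  equivalent : ∀ {p q} {P : Set p} {Q : Set q} {g pos} → (P → Q) → (Q → P) →
               HasOutcome g pos P → HasOutcome g pos Q
  equivalent to from (b , run , r) = b , run , reflects-map to from r

  compare-lists : ∀ us ws {g s p n v} →
    HasOutcome g (state compare (map comparable ws) s p n (map comparable us) v) (¬ us ≡ ws)
  compare-heads : ∀ {u w us ws g s p n v} (d : Dec (u ≡ w)) →
    HasOutcome g (state (if does d then compare else win) (map comparable ws) s p n (map comparable us) v)
      (¬ _≡_ {A = List Comparable} (u ∷ us) (w ∷ ws))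
  compare-heads {us = us} {ws} (yes refl) =
    equivalent (λ us≢ws eq → us≢ws (proj₂ (∷-injective eq))) (λ ne eq → ne (cong (_ ∷_) eq)) (compare-lists us ws)
  compare-heads (no u≢w) = true , halting refl , ofʸ λ eq → u≢w (proj₁ (∷-injective eq))

  compare-lists []           []           = false , popping refl (popping refl (halting refl)) , ofⁿ λ ¬refl → ¬refl refl
  compare-lists []           (_ ∷ _)      = true , popping refl (popping refl (halting refl)) , ofʸ λ ()
  compare-lists (inj₁ _ ∷ _) []           = true , popping refl (popping refl (halting refl)) , ofʸ λ ()
  compare-lists (inj₂ _ ∷ _) []           = true , popping refl (popping refl (halting refl)) , ofʸ λ ()
  compare-lists (inj₁ _ ∷ _) (inj₂ _ ∷ _) = true , popping refl (popping refl (halting refl)) , ofʸ λ ()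
  compare-lists (inj₂ _ ∷ _) (inj₁ _ ∷ _) = true , popping refl (popping refl (halting refl)) , ofʸ λ ()
  compare-lists (inj₁ x ∷ us) (inj₁ y ∷ ws) =
    (λ run → popping refl (popping refl run)) after compare-heads (Dec.map′ (cong inj₁) (λ { refl → refl }) (x Bool.≟ y))
  compare-lists (inj₂ x ∷ us) (inj₂ y ∷ ws) =
    (λ run → popping refl (popping refl run)) after compare-heads (Dec.map′ (cong inj₂) (λ { refl → refl }) (x Fin.≟ y))

  -- The literal marked second is compared with its sign reversed.

  mirror : Bool × ATM → List Comparable
  mirror (b , i) = inj₁ b ∷ (map inj₂ (digits i) ʳ++ [])

  negated : Bool × ATM → Bool × ATM
  negated (b , i) = not b , i

  map-mirror : ∀ b i → map comparable (mirror (b , i)) ≡ signed b ∷ (map digit-letter (digits i) ʳ++ [])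
  map-mirror b i = cong (signed b ∷_) (trans (map-ʳ++ comparable (map inj₂ (digits i))) (cong (_ʳ++ []) (≡-sym (map-∘ (digits i)))))

  mirror-injective : ∀ {x y} → mirror x ≡ mirror y → x ≡ y
  mirror-injective {b , i} {b′ , j} eq with refl , eq′ ← ∷-injective eq =
    cong (b ,_) (digits-injective (map-injective (λ { refl → refl }) (reverse-injective eq′)))

  mirror-compatible : ∀ x y → ¬ mirror (negated y) ≡ mirror x → Compatible x y
  mirror-compatible (b , i) (b′ , .i) distinct refl with b Bool.≟ b′
  ... | yes b≡b′ = b≡b′
  ... | no b≢b′  = ⊥-elim (distinct (cong (λ b → mirror (b , i)) (≡-sym (Bool.¬-not b≢b′))))

  compatible-mirror : ∀ x y → Compatible x y → ¬ mirror (negated y) ≡ mirror x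
  compatible-mirror (b , i) (b′ , j) compatible eq with mirror-injective {not b′ , j} {b , i} eq
  ... | refl with () ← Bool.not-¬ {b′} refl (≡-sym (compatible refl))

  both : ∀ {a b} {P : Set a} {Q : Set b} {g l t₀ t₁ m s p n c v} → instr l ≡ choose Refuter t₀ t₁ →
         HasOutcome g (position t₀ [] (m ∷ s ∷ p ∷ n ∷ c ∷ v ∷ [])) P →
         HasOutcome g (position t₁ [] (m ∷ s ∷ p ∷ n ∷ c ∷ v ∷ [])) Q →
         HasOutcome (suc g) (state l m s p n c v) (P × Q)
  both eq (_ , run₀ , r₀) (_ , run₁ , r₁) = _ , choosing eq run₀ run₁ , (r₀ ×-reflects r₁)

  either : ∀ {a b} {P : Set a} {Q : Set b} {g l t₀ t₁ m s p n c v} → instr l ≡ choose Verifier t₀ t₁ →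
           HasOutcome g (position t₀ [] (m ∷ s ∷ p ∷ n ∷ c ∷ v ∷ [])) P →
           HasOutcome g (position t₁ [] (m ∷ s ∷ p ∷ n ∷ c ∷ v ∷ [])) Q →
           HasOutcome (suc g) (state l m s p n c v) (P ⊎ Q)
  either eq (_ , run₀ , r₀) (_ , run₁ , r₁) = _ , choosing eq run₀ run₁ , (r₀ ⊎-reflects r₁)

  winning : ∀ {p} {P : Set p} {g m s p n c v} → P → HasOutcome g (state win m s p n c v) P
  winning x = true , halting refl , ofʸ x

  -- The budget does not depend on the length of `v`: the choice to pass over a literal is paid for
  -- by popping its sign. This is why literals do not count in `cost`.
  second-literal : ∀ x v {g s p n} →
    HasOutcome (suc g) (state second (map comparable (mirror x)) s p n [] (encode-literals v)) (All (Compatible x) v)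
  second-literal x [] = equivalent (λ _ → []) (λ _ → _ , _)
    (both refl (popping refl after winning tt) (popping refl after winning tt))
  second-literal x (y@(b , i) ∷ v) {g} {s} {p} {n} = equivalent (λ (c , cs) → cs ∷ c) (λ { (c ∷ cs) → cs , c })
    (both refl
      ((λ run → pour (λ l _ → state skip-second m s p n [] l) (digits i) {k = []} (λ d run → popping refl (weaken (n≤1+n _) run)) (popping refl run))
        after second-literal x v)
      ((λ run → pour (λ l c → state mark-second m s p n c l) (digits i) (λ d run → popping refl (pushing run)) (popping refl (pushing run)))
        after subst (λ c → HasOutcome g (state compare m s p n c (encode-literals v)) (Compatible x y)) (map-mirror (not b) i)
          (equivalent (mirror-compatible x y) (compatible-mirror x y) (compare-lists (mirror (negated y)) (mirror x)))))
    where m = map comparable (mirror x)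

  first-literal : ∀ v {g s p n} →
    HasOutcome (suc (suc g)) (state first [] s p n [] (encode-literals v)) (AllPairs Compatible v)
  first-literal [] = equivalent (λ _ → []) (λ _ → _ , _)
    (both refl (popping refl after winning tt) (popping refl after winning tt))
  first-literal (x@(b , i) ∷ v) {g} {s} {p} {n} = equivalent (λ (c , cs) → cs ∷ c) (λ { (c ∷ cs) → cs , c })
    (both refl
      ((λ run → pour (λ l _ → state skip-first [] s p n [] l) (digits i) {k = []} (λ d run → popping refl (weaken (n≤1+n _) run)) (popping refl run))
        after first-literal v)
      ((λ run → pour (λ l m → state mark-first m s p n [] l) (digits i) (λ d run → popping refl (pushing run)) (popping refl (pushing run)))
        after subst (λ m → HasOutcome (suc g) (state second m s p n [] (encode-literals v)) (All (Compatible x) v)) (map-mirror b i)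
          (second-literal x v)))

  conf : Sequent → Position
  conf (sequent t p n v) =
    state main (encode-todo t) (encode-signs t) (encode-pairs p) (encode-pairs n) [] (encode-literals v)

  Solution : Sequent → Set₁
  Solution s = HasOutcome (cost s) (conf s) (Satisfiable s)

  Solved : ℕ → Set₁
  Solved n = ∀ s → cost s < n → Solution s

  -- The test for emptiness pops a symbol and puts it back; it computes only once the first leaf of
  -- `A` exposes that symbol.
  enter-next : ∀ A {g b m s k n c v} → Run g (state decide-next m s (encodeʳ A k) n c v) b →
               Run g (state next m s (encodeʳ A k) n c v) b
  enter-next (var _) run = popping refl (pushing run)
  enter-next ⊥′      run = popping refl (pushing run)
  enter-next (A ⟶ B) run = enter-next A run
  enter-next (A ⇒ B) run = enter-next A run

  -- With no holding conditional left this is the cost of the next set of signed formulas, with its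
  -- 6, plus 1 for the mark of the antecedent.
  need : Formula → List (Formula × Formula) → List (Sign × Formula) → ℕ
  need C holding todo = 7 + (weights holding + (weight todo + ⟪ C ⟫))

  module _ {n : ℕ} (solved : Solved n) where

    challenge-outcome : ∀ b A C {g m s k} → cost (goals ((⊖ , C) ∷ (⊕ , A) ∷ [])) ≤ g →
      cost (goals ((⊖ , C) ∷ (⊕ , A) ∷ [])) < n →
      HasOutcome (suc g) (state (challenge b) m s (encodeʳ A (♯ ∷ k)) (encodeʳ C []) [] [])
        (Satisfiable (goals (((if b then ⊖ else ⊕) , C) ∷ ((if b then ⊕ else ⊖) , A) ∷ [])))
    challenge-outcome b A C {g} {m} {s} {k} ≤g <n = go after finally b
      where
      goal : Bool → Sequent
      goal b = goals (((if b then ⊖ else ⊕) , C) ∷ ((if b then ⊕ else ⊖) , A) ∷ [])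
      finally : ∀ b → HasOutcome g (state main (encode C (encode A [])) (signed (not b) ∷ signed b ∷ []) [] [] [] [])
                        (Satisfiable (goal b))
      finally true  = weaken ≤g after solved (goal true) <n
      finally false = weaken ≤g after solved (goal false) <n
      go : ∀ {out} → Run g (state main (encode C (encode A [])) (signed (not b) ∷ signed b ∷ []) [] [] [] []) out →
           Run (suc g) (state (challenge b) m s (encodeʳ A (♯ ∷ k)) (encodeʳ C []) [] []) out
      go run =
        clear (λ s → state (challenge b) m s _ _ [] []) (λ x → popping refl) s (popping refl
        (clear (λ m → state (clear-formulas b) m [] _ _ [] []) (λ x → popping refl) m (popping refl
        (Transfer.unstack (λ p m → state (take-antecedent′ b) m [] p (encodeʳ C []) [] []) (λ x run → popping refl (pushing run)) A {[]} {♯ ∷ k} (popping refl (pushing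
        (clear (λ p → state (clear-holding b) (encode A []) (signed b ∷ []) p (encodeʳ C []) [] []) (λ x → popping refl) k (popping refl
        (Transfer.unstack (λ n m → state (finish-challenge b) m (signed b ∷ []) [] n [] []) (λ x run → popping refl (pushing run)) C {encode A []} {[]} (popping refl (pushing run)))))))))))

    select-outcome : ∀ C holding todo → need C holding todo ≤ n →
      HasOutcome (need C holding todo)
        (state next (encode-todo todo) (encode-signs todo) (encode-pairs holding) (encodeʳ C []) [] [])
        (Selectable C holding todo)
    select-outcome C [] todo ≤n =
      (λ run → popping refl (Transfer.unstack (λ n m → state finish m (encode-signs todo) [] n [] [])
                 (λ x run → popping refl (pushing run)) C (popping refl (pushing (weaken enough run)))))
      after solved (goals ((antecedent-sign reflexive , C) ∷ todo)) (≤-trans (s≤s enough) ≤n)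
      where
      arith : ∀ c t → 6 + (0 + (t + c)) ≡ 0 + (6 + ((c + t) + (0 + 0)))
      arith = solve-∀
      enough : cost (goals ((antecedent-sign reflexive , C) ∷ todo)) ≤ 6 + (0 + (weight todo + ⟪ C ⟫))
      enough = by-excess 0 (arith ⟪ C ⟫ (weight todo))
    select-outcome C ((A , B) ∷ holding) todo ≤n =
      enter-next A after
      either refl
        ((λ run → discard (λ p → state include m s p _ [] []) (λ x → popping refl) A (popping refl
            (Transfer.unstack (λ p m → state take-consequent′ m s p _ [] []) (λ x run → popping refl (pushing run)) B
              (popping refl (pushing (weaken enough-included run))))))
          after select-outcome C holding ((⊕ , B) ∷ todo) (≤-trans enough-included ≤n))
        (either refl (both refl accepted (challenge-outcome true A C enough-challenge below))
                     (both refl accepted (challenge-outcome false A C enough-challenge below)))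
      where
      m = encode-todo todo
      s = encode-signs todo
      X = weights ((A , B) ∷ holding) + (weight todo + ⟪ C ⟫)
      included : ∀ a b c t w → 7 + (((4 + (a + b)) + w) + (t + c)) ≡ (4 + a) + (7 + (w + ((b + t) + c)))
      included = solve-∀
      enough-included : need C holding ((⊕ , B) ∷ todo) ≤ 7 + X
      enough-included = by-excess (4 + ⟪ A ⟫) (included ⟪ A ⟫ ⟪ B ⟫ ⟪ C ⟫ (weight todo) (weights holding))
      excluded : ∀ a b c t w → 6 + (((4 + (a + b)) + w) + (t + c)) ≡ (3 + a + b) + (7 + (w + (t + c)))
      excluded = solve-∀
      enough-accepted : need C holding todo ≤ 6 + X
      enough-accepted = by-excess (3 + ⟪ A ⟫ + ⟪ B ⟫) (excluded ⟪ A ⟫ ⟪ B ⟫ ⟪ C ⟫ (weight todo) (weights holding))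
      challenged : ∀ a b c t w → 3 + (((4 + (a + b)) + w) + (t + c)) ≡ (1 + b + w + t) + (6 + ((c + (a + 0)) + (0 + 0)))
      challenged = solve-∀
      enough-challenge : cost (goals ((⊖ , C) ∷ (⊕ , A) ∷ [])) ≤ 3 + X
      enough-challenge = by-excess (1 + ⟪ B ⟫ + weights holding + weight todo)
        (challenged ⟪ A ⟫ ⟪ B ⟫ ⟪ C ⟫ (weight todo) (weights holding))
      below : cost (goals ((⊖ , C) ∷ (⊕ , A) ∷ [])) < n
      below = ≤-trans (s≤s enough-challenge) (≤-trans (m≤n+m (4 + X) 3) ≤n)
      accepted : HasOutcome (4 + X) (state accept m s (encode-pairs ((A , B) ∷ holding)) (encodeʳ C []) [] [])
                   (Selectable C holding todo)
      accepted =
        (λ run → discard (λ p → state accept m s p _ [] []) (λ x → popping refl) A (popping refl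
                (discard (λ p → state drop-consequent m s p _ [] []) (λ x → popping refl) B (popping refl
                  (weaken enough-accepted run)))))
        after select-outcome C holding todo (≤-trans enough-accepted (≤-trans (n≤1+n _) ≤n))

    pick-outcome : ∀ holding failing → 6 + (weights holding + weights failing) ≤ n →
      HasOutcome (5 + (weights holding + weights failing))
        (state pick [] [] (encode-pairs holding) (encode-pairs failing) [] [])
        (All (Realizable holding) failing)
    pick-outcome holding [] ≤n = equivalent (λ _ → []) (λ _ → _ , _)
      (both refl (popping refl after winning tt) (popping refl after winning tt))
    pick-outcome holding ((C , E) ∷ failing) ≤n = equivalent (λ (r , rs) → rs ∷ r) (λ { (r ∷ rs) → rs , r })
      (both refl
        ((λ run → discard (λ n → state pass-antecedent [] [] _ n [] []) (λ x → popping refl) C (popping refl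
                 (discard (λ n → state pass-consequent [] [] _ n [] []) (λ x → popping refl) E (popping refl
                   (weaken enough-passed run)))))
          after pick-outcome holding failing (≤-trans enough-passed′ ≤n))
        ((λ run → Transfer.unstack (λ n c → state take-antecedent [] [] P n c []) (λ x run → popping refl (pushing run)) C {[]} {♯ ∷ encodeʳ E (♯ ∷ encode-pairs failing)} (popping refl
                 (Transfer.unstack (λ n m → state take-consequent m [] P n (encode C []) []) (λ x run → popping refl (pushing run)) E {[]} {♯ ∷ encode-pairs failing} (popping refl (pushing
                 (clear (λ n → state clear-failing (encode E []) (signed false ∷ []) P n (encode C []) []) (λ x → popping refl) (encode-pairs failing) (popping refl
                 (Transfer.stack (λ c n → state restore (encode E []) (signed false ∷ []) P n c []) (λ x run → popping refl (pushing run)) C {[]} {[]} (popping refl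
                   (weaken enough-taken run))))))))))
          after select-outcome C holding ((⊖ , E) ∷ []) (≤-trans enough-taken (≤-trans (n≤1+n _) ≤n))))
      where
      P = encode-pairs holding
      Y = weights holding + weights ((C , E) ∷ failing)
      passed : ∀ c e w f → 6 + (w + ((4 + (c + e)) + f)) ≡ (4 + c + e) + (6 + (w + f))
      passed = solve-∀
      enough-passed′ : 6 + (weights holding + weights failing) ≤ 6 + Y
      enough-passed′ = by-excess (4 + ⟪ C ⟫ + ⟪ E ⟫) (passed ⟪ C ⟫ ⟪ E ⟫ (weights holding) (weights failing))
      enough-passed : 5 + (weights holding + weights failing) ≤ 6 + Y
      enough-passed = ≤-trans (n≤1+n _) enough-passed′
      taken : ∀ c e w f → 5 + (w + ((4 + (c + e)) + f)) ≡ (2 + f) + (7 + (w + ((e + 0) + c)))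
      taken = solve-∀
      enough-taken : need C holding ((⊖ , E) ∷ []) ≤ 5 + Y
      enough-taken = by-excess (2 + weights failing) (taken ⟪ C ⟫ ⟪ E ⟫ (weights holding) (weights failing))

    world-outcome : ∀ p m v → cost (sequent [] p m v) ≤ n → Solution (sequent [] p m v)
    world-outcome p m v ≤n =
      popping refl after equivalent realized⇒satisfiable satisfiable⇒realized
        (both refl (first-literal v)
          ((λ run → clear (λ l → state clear-literals [] [] _ _ [] l) (λ x → popping refl) (encode-literals v) (popping refl run))
            after pick-outcome p m ≤n))

  satisfiable-map : ∀ {s s′} → (∀ {M} → Admissible M → ∀ {w} → Semantics._⊨ˢ_ M w s → Semantics._⊨ˢ_ M w s′) →
                    Satisfiable s → Satisfiable s′
  satisfiable-map f (M , adm , w , h) = M , adm , w , f adm h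

  open Semantics using (satisfies)

  cost-operator : ∀ a b t r → 5 + (((5 + (b + a)) + t) + r) ≡ 4 + (6 + ((b + (a + t)) + r))
  cost-operator = solve-∀

  cost-holding : ∀ a b t p n → 5 + (((5 + (b + a)) + t) + (p + n)) ≡ 0 + (6 + (t + (((4 + (a + b)) + p) + n)))
  cost-holding = solve-∀

  cost-failing : ∀ a b t p n → 5 + (((5 + (b + a)) + t) + (p + n)) ≡ 0 + (6 + (t + (p + ((4 + (a + b)) + n))))
  cost-failing = solve-∀

  operators≤cost : ∀ c {a t} k → operators c ≤ ⟪ c ⟫ → ⟪ c ⟫ ≤ a → operators c ≤ k + (a + t)
  operators≤cost c k o a = ≤-trans o (≤-trans a (m≤n⇒m≤o+n k (m≤m+n _ _)))

  positive : ∀ A → 1 ≤ ⟪ A ⟫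
  positive (var _) = s≤s z≤n
  positive ⊥′      = s≤s z≤n
  positive (_ ⟶ _) = s≤s z≤n
  positive (_ ⇒ _) = s≤s z≤n

  -- Recursion is on a strict bound for the cost, since the sets reached through a failing
  -- conditional are not structurally smaller.
  solve : ∀ n → Solved n
  solve (suc n) (sequent [] p m v) (s≤s ≤n) = world-outcome (solve n) p m v ≤n
  solve (suc n) (sequent ((⊘ , A) ∷ t) p m v) (s≤s ≤n) =
    (λ run → popping refl (ignore-formula A (weaken (≤-trans (n≤1+n _) (m≤n⇒m≤1+n less)) run)))
    after equivalent
      (satisfiable-map λ { _ (satisfies hs ps ns ls) → satisfies (tt ∷ hs) ps ns ls })
      (satisfiable-map λ { _ (satisfies (_ ∷ hs) ps ns ls) → satisfies hs ps ns ls })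
      (solve n (sequent t p m v) (≤-trans less ≤n))
    where
    less : cost (sequent t p m v) < cost (sequent ((⊘ , A) ∷ t) p m v)
    less = +-monoʳ-≤ 6 (+-monoˡ-≤ (weights p + weights m) (+-monoˡ-≤ (weight t) (positive A)))
  solve (suc n) (sequent ((⊕ , var i) ∷ t) p m v) (s≤s ≤n) =
    (λ run → popping refl (store-literal true i (weaken (n≤1+n _) run)))
    after equivalent
      (satisfiable-map λ { _ (satisfies hs ps ns (l ∷ ls)) → satisfies (l ∷ hs) ps ns ls })
      (satisfiable-map λ { _ (satisfies (l ∷ hs) ps ns ls) → satisfies hs ps ns (l ∷ ls) })
      (solve n (sequent t p m ((true , i) ∷ v)) ≤n)
  solve (suc n) (sequent ((⊖ , var i) ∷ t) p m v) (s≤s ≤n) =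
    (λ run → popping refl (store-literal false i (weaken (n≤1+n _) run)))
    after equivalent
      (satisfiable-map λ { _ (satisfies hs ps ns (l ∷ ls)) → satisfies (l ∷ hs) ps ns ls })
      (satisfiable-map λ { _ (satisfies (l ∷ hs) ps ns ls) → satisfies hs ps ns (l ∷ ls) })
      (solve n (sequent t p m ((false , i) ∷ v)) ≤n)
  solve (suc n) (sequent ((⊕ , ⊥′) ∷ t) p m v) (s≤s ≤n) =
    false , popping refl (popping refl (halting refl)) ,
    ofⁿ λ { (_ , _ , _ , satisfies (() ∷ _) _ _ _) }
  solve (suc n) (sequent ((⊖ , ⊥′) ∷ t) p m v) (s≤s ≤n) =
    (λ run → popping refl (popping refl (weaken (m≤n+m _ 3) run)))
    after equivalent
      (satisfiable-map λ { _ (satisfies hs ps ns ls) → satisfies ((λ ()) ∷ hs) ps ns ls })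
      (satisfiable-map λ { _ (satisfies (_ ∷ hs) ps ns ls) → satisfies hs ps ns ls })
      (solve n (sequent t p m v) ≤n)
  solve (suc n) (sequent ((⊕ , A ⟶ B) ∷ t) p m v) (s≤s ≤n) =
    (λ run → popping refl (popping refl run))
    after equivalent
      (λ { (inj₁ sat) → satisfiable-map (λ { _ (satisfies (_ ∷ ¬a ∷ hs) ps ns ls) → satisfies (inj₁ ¬a ∷ hs) ps ns ls }) sat
         ; (inj₂ sat) → satisfiable-map (λ { _ (satisfies (b ∷ _ ∷ hs) ps ns ls) → satisfies (inj₂ b ∷ hs) ps ns ls }) sat })
      (λ { (M , adm , w , satisfies (inj₁ ¬a ∷ hs) ps ns ls) → inj₁ (M , adm , w , satisfies (tt ∷ ¬a ∷ hs) ps ns ls)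
         ; (M , adm , w , satisfies (inj₂ b ∷ hs) ps ns ls)  → inj₂ (M , adm , w , satisfies (b ∷ tt ∷ hs) ps ns ls) })
      (either refl
        ((λ run → pushing (pushing (weaken enough run))) after
          solve n (sequent ((⊘ , B) ∷ (⊖ , A) ∷ t) p m v) (≤-trans less ≤n))
        ((λ run → pushing (pushing (weaken enough run))) after
          solve n (sequent ((⊕ , B) ∷ (⊘ , A) ∷ t) p m v) (≤-trans less ≤n)))
    where
    c = 6 + ((⟪ B ⟫ + (⟪ A ⟫ + weight t)) + (weights p + weights m))
    enough : c ≤ 5 + (((5 + (⟪ B ⟫ + ⟪ A ⟫)) + weight t) + (weights p + weights m))
    enough = by-excess 4 (cost-operator ⟪ A ⟫ ⟪ B ⟫ (weight t) (weights p + weights m))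
    less : c < 6 + (((5 + (⟪ B ⟫ + ⟪ A ⟫)) + weight t) + (weights p + weights m))
    less = s≤s enough
  solve (suc n) (sequent ((⊖ , A ⟶ B) ∷ t) p m v) (s≤s ≤n) =
    (λ run → popping refl (popping refl (pushing (pushing (weaken (m≤n⇒m≤1+n enough) run)))))
    after equivalent
      (satisfiable-map λ { _ (satisfies (¬b ∷ a ∷ hs) ps ns ls) →
        satisfies ((λ { (inj₁ ¬a) → ¬a a ; (inj₂ b) → ¬b b }) ∷ hs) ps ns ls })
      (satisfiable-map λ { _ (satisfies (¬h ∷ hs) ps ns ls) →
        satisfies ((λ b → ¬h (inj₂ b)) ∷ by-contradiction (λ ¬a → ¬h (inj₁ ¬a)) ∷ hs) ps ns ls })
      (solve n (sequent ((⊖ , B) ∷ (⊕ , A) ∷ t) p m v) (≤-trans (s≤s enough) ≤n))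
    where
    enough : 6 + ((⟪ B ⟫ + (⟪ A ⟫ + weight t)) + (weights p + weights m)) ≤
             5 + (((5 + (⟪ B ⟫ + ⟪ A ⟫)) + weight t) + (weights p + weights m))
    enough = by-excess 4 (cost-operator ⟪ A ⟫ ⟪ B ⟫ (weight t) (weights p + weights m))
  solve (suc n) (sequent ((⊕ , A ⇒ B) ∷ t) p m v) (s≤s ≤n) =
    (λ run → popping refl (popping refl (pushing (pushing (popping refl (pushing
      (copy-holding B (operators≤cost B 6 (operators≤⟪⟫ B) (≤-trans (m≤n⇒m≤o+n 5 (m≤m+n _ _)) (m≤m+n _ _))) (popping refl (pushing
        (copy-holding A (operators≤cost A 6 (operators≤⟪⟫ A) (≤-trans (m≤n⇒m≤o+n 5 (m≤n+m _ ⟪ B ⟫)) (m≤m+n _ _)))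
          (weaken (m≤n⇒m≤1+n enough) run)))))))))))
    after equivalent
      (satisfiable-map λ { _ (satisfies hs (h ∷ ps) ns ls) → satisfies ((λ {u} → h {u}) ∷ hs) ps ns ls })
      (satisfiable-map λ { _ (satisfies (h ∷ hs) ps ns ls) → satisfies hs ((λ {u} → h {u}) ∷ ps) ns ls })
      (solve n (sequent t ((A , B) ∷ p) m v) (≤-trans (s≤s enough) ≤n))
    where
    enough : cost (sequent t ((A , B) ∷ p) m v) ≤ 5 + (((5 + (⟪ B ⟫ + ⟪ A ⟫)) + weight t) + (weights p + weights m))
    enough = by-excess 0 (cost-holding ⟪ A ⟫ ⟪ B ⟫ (weight t) (weights p) (weights m))
  solve (suc n) (sequent ((⊖ , A ⇒ B) ∷ t) p m v) (s≤s ≤n) =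
    (λ run → popping refl (popping refl (pushing (pushing (popping refl (pushing
      (copy-failing B (operators≤cost B 6 (operators≤⟪⟫ B) (≤-trans (m≤n⇒m≤o+n 5 (m≤m+n _ _)) (m≤m+n _ _))) (popping refl (pushing
        (copy-failing A (operators≤cost A 6 (operators≤⟪⟫ A) (≤-trans (m≤n⇒m≤o+n 5 (m≤n+m _ ⟪ B ⟫)) (m≤m+n _ _)))
          (weaken (m≤n⇒m≤1+n enough) run)))))))))))
    after equivalent
      (satisfiable-map λ { _ (satisfies hs ps (h ∷ ns) ls) → satisfies (h ∷ hs) ps ns ls })
      (satisfiable-map λ { _ (satisfies (h ∷ hs) ps ns ls) → satisfies hs ps (h ∷ ns) ls })
      (solve n (sequent t p ((A , B) ∷ m) v) (≤-trans (s≤s enough) ≤n))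
    where
    enough : cost (sequent t p ((A , B) ∷ m) v) ≤ 5 + (((5 + (⟪ B ⟫ + ⟪ A ⟫)) + weight t) + (weights p + weights m))
    enough = by-excess 0 (cost-failing ⟪ A ⟫ ⟪ B ⟫ (weight t) (weights p) (weights m))

  -- Loading the input formula.

  loading : (x : List Symbol) (m s : List Alphabet) → Position
  loading x m s = position (goto load) x (m ∷ s ∷ [] ∷ [] ∷ [] ∷ [] ∷ [])

  load-digits : ∀ ds {g b x m s} → Run g (loading x (map digit-letter ds ʳ++ m) s) b →
                Run (length ds + g) (loading (map digit ds ++ x) m s) b
  load-digits []       run = run
  load-digits (d ∷ ds) run = reading refl (pushing (load-digits ds run))

  unfold : ∀ A σ B x → (string A ++ σ ∷ string B ++ [ rpar ]) ++ x ≡ string A ++ σ ∷ string B ++ rpar ∷ x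
  unfold A σ B x = trans (++-assoc (string A) _ x) (cong (λ y → string A ++ σ ∷ y) (++-assoc (string B) [ rpar ] x))

  length-binary : ∀ A (σ : Symbol) B → length (lpar ∷ string A ++ σ ∷ string B ++ [ rpar ]) ≡ suc (∣ A ∣ + suc (∣ B ∣ + 1))
  length-binary A σ B = cong suc (trans (length-++ (string A)) (cong (λ k → ∣ A ∣ + suc k) (length-++ (string B))))

  loading-cost : ∀ A σ B {g} → ∣ A ∣ + suc (∣ B ∣ + g) ≤ length (lpar ∷ string A ++ σ ∷ string B ++ [ rpar ]) + g
  loading-cost A σ B {g} = by-excess 2 (trans (cong (_+ g) (length-binary A σ B)) (arith ∣ A ∣ ∣ B ∣ g))
    where
    arith : ∀ a b g → suc (a + suc (b + 1)) + g ≡ 2 + (a + suc (b + g))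
    arith = solve-∀

  complexity-binary : ∀ A σ B → ⟪ A ⟫ ≤ 5 * ∣ A ∣ → ⟪ B ⟫ ≤ 5 * ∣ B ∣ →
    5 + (⟪ B ⟫ + ⟪ A ⟫) ≤ 5 * length (lpar ∷ string A ++ σ ∷ string B ++ [ rpar ])
  complexity-binary A σ B a b = ≤-trans (+-monoʳ-≤ 5 (+-mono-≤ b a))
    (by-excess 10 (trans (cong (5 *_) (length-binary A σ B)) (arith ∣ A ∣ ∣ B ∣)))
    where
    arith : ∀ a b → 5 * suc (a + suc (b + 1)) ≡ 10 + (5 + (5 * b + 5 * a))
    arith = solve-∀

  -- Each input symbol pushes at most one letter, and a closing parenthesis only moves one between
  -- stacks, so the length of the string pays for loading.
  load-formula : ∀ A {g b x m s} → Run g (loading x (encode A m) s) b →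
                 Run (∣ A ∣ + g) (loading (string A ++ x) m s) b
  load-formula (var i) {g} {b} {x} {m} {s} run rewrite length-map digit (digits i) =
    reading refl (pushing (load-digits (digits i) run))
  load-formula ⊥′      run = reading refl (pushing run)
  load-formula (A ⟶ B) {x = x} run =
    subst (λ y → Run _ (loading (lpar ∷ y) _ _) _) (≡-sym (unfold A imp B x))
      (weaken (loading-cost A imp B)
        (reading refl (load-formula A (reading refl (pushing (load-formula B (reading refl (popping refl (pushing run)))))))))
  load-formula (A ⇒ B) {x = x} run =
    subst (λ y → Run _ (loading (lpar ∷ y) _ _) _) (≡-sym (unfold A cond B x))
      (weaken (loading-cost A cond B)
        (reading refl (load-formula A (reading refl (pushing (load-formula B (reading refl (popping refl (pushing run)))))))))

  complexity≤length : ∀ A → ⟪ A ⟫ ≤ 5 * ∣ A ∣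
  complexity≤length (var i) = s≤s z≤n
  complexity≤length ⊥′      = s≤s z≤n
  complexity≤length (A ⟶ B) = complexity-binary A imp B (complexity≤length A) (complexity≤length B)
  complexity≤length (A ⇒ B) = complexity-binary A cond B (complexity≤length A) (complexity≤length B)

  outcome : ∀ D → ∃[ b ] (Run (work-space ∣ D ∣) (position (goto load) (string D) empty) b ×
                          Reflects (Satisfiable (goals [ ⊖ , D ])) b)
  outcome D = start after solve _ (goals [ ⊖ , D ]) ≤-refl
    where
    enough : cost (goals [ ⊖ , D ]) ≤ 6 + 5 * ∣ D ∣
    enough = +-monoʳ-≤ 6 (≤-trans (≤-reflexive (trans (+-identityʳ _) (+-identityʳ _))) (complexity≤length D))
    start : ∀ {b} → Run (cost (goals [ ⊖ , D ])) (conf (goals [ ⊖ , D ])) b →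
            Run (work-space ∣ D ∣) (position (goto load) (string D) empty) b
    start run = subst (λ x → Run (work-space ∣ D ∣) (loading x [] []) _) (++-identityʳ (string D))
      (load-formula D (reading refl (pushing (weaken enough run))))

  -- From satisfiability to provability in CK and CK+ID.

  Valid : Pred Formula (lsuc 0ℓ)
  Valid D = (M : Model) → Admissible M → Universal (Model.⟦_⟧ M D)

  unsatisfiable⇒valid : ∀ {D} → ¬ Satisfiable (goals [ ⊖ , D ]) → Valid D
  unsatisfiable⇒valid ¬sat M adm w = by-contradiction λ ¬d → ¬sat (M , adm , w , satisfies (¬d ∷ []) [] [] [])

  valid⇒unsatisfiable : ∀ {D} → Valid D → ¬ Satisfiable (goals [ ⊖ , D ])
  valid⇒unsatisfiable valid (M , adm , w , satisfies (¬d ∷ []) _ _ _) = ¬d (valid M adm w)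

  open Simulate (prover reflexive)

  decidable : DecidableInSpaceO (λ n → n * ⌊log₂ n ⌋) Valid
  decidable =
    machine ,
    (λ D → let b , run , r = outcome D in
       not b , proj₁ (simulation run) , reflects-map unsatisfiable⇒valid valid⇒unsatisfiable (¬-reflects r)) ,
    _ , linear-in-O tape-bits , λ D → proj₂ (simulation (proj₁ (proj₂ (outcome D))))

decidable-≐ : ∀ {g L L′} → (∀ {D} → L D → L′ D) → (∀ {D} → L′ D → L D) →
              DecidableInSpaceO g L → DecidableInSpaceO g L′
decidable-≐ to from (M , decides , bounded) =
  M , (λ D → let b , out , r = decides D in b , out , reflects-map to from r) , bounded

theorem4p32 : ExcludedMiddle 0ℓ →
    DecidableInSpaceO (λ n → n * ⌊log₂ n ⌋) CK × DecidableInSpaceO (λ n → n * ⌊log₂ n ⌋) CK+ID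
theorem4p32 em =
  decidable-≐ {L = Correctness.Valid em false} (λ valid M → valid M λ ()) (λ valid M _ → valid M) (Correctness.decidable em false) ,
  decidable-≐ {L = Correctness.Valid em true} (λ valid M adm → valid M λ _ → adm) (λ valid M adm → valid M (adm refl)) (Correctness.decidable em true)
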